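{- Let $q$ be a prime power, let $M$ be a simple rank-$r$ matroid representable over $GF(q)$, and let $w$ be a weight function on $M$. Suppose $M\not\cong P_r$. Then $$\frac{w(M)}{g^\ast(M)}\geq \frac{q}{q-1}.$$ Moreover, equality holds if and only if, for a fixed embedding of $M$ as a restriction of $P_r$: (i) the complement of $M$ in $P_r$ (the restriction of $P_r$ to the points not in $E(M)$) is isomorphic to $P_k$, with $1\leq k<r$; (ii) if $P$ is a restriction of $P_r$ isomorphic to $P_{k+1}$ that contains the complement of $M$ in $P_r$, then $w$ is constant on $E(P)\cap E(M)$; and (iii) $w(N)\geq (q-1)\,w(E(M)-E(N))$ for every restriction $N$ of $M$ isomorphic to $A_r$.
   Context: $P_r$ denotes $PG(r-1,q)$ and $A_r$ denotes $AG(r-1,q)$. A weight function on a simple matroid $M$ is a function $w:E(M)\to\mathbb{Z}_{>0}$; for $X\subseteq E(M)$, $w(X)=\sum_{x\in X}w(x)$, $w(M)=w(E(M))$, and for a restriction $N$ of $M$, $w(N)=w(E(N))$. The cogirth $g^\ast(M)$ of a weighted matroid is the minimum weight of a cocircuit of $M$. -}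

module Defs where

open import Level using (0ℓ)
open import Data.Nat using (ℕ; zero; suc; _∸_; _≤_; _<_)
import Data.Nat as ℕ
open import Data.Bool using (Bool; true; false; T; not; _∧_; if_then_else_)
open import Data.List using (List; []; _∷_; length; map; concatMap; mapMaybe)
open import Data.Nat.ListAction using (sum)
open import Data.List.Relation.Unary.All using (All)
open import Data.List.Relation.Unary.Unique.Propositional using (Unique)
open import Data.List.Membership.Propositional using (_∈_)
open import Data.Maybe using (Maybe; just; nothing)
open import Data.Vec using (Vec; []; _∷_; replicate; zipWith)
import Data.Vec as V
open import Data.Product using (Σ; Σ-syntax; ∃; ∃-syntax; _×_; _,_; proj₁; proj₂)
open import Function using (_∘_)
open import Function.Bundles using (_⇔_)
open import Relation.Binary.PropositionalEquality using (_≡_)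
open import Relation.Nullary using (¬_; Dec; yes; no)
open import Relation.Nullary.Decidable using (⌊_⌋; T?)
open import Algebra.Structures using (IsCommutativeRing)

-- Finite fields.  GF(q) is (up to isomorphism) the unique finite field
-- with q elements; we let it be an arbitrary finite field whose number
-- of elements is q.

record FiniteField : Set₁ where
  field
    Carrier : Set
    _≟_     : (x y : Carrier) → Dec (x ≡ y)
    _+_ _*_ : Carrier → Carrier → Carrier
    -_      : Carrier → Carrier
    0# 1#   : Carrier
    isCommutativeRing : IsCommutativeRing _≡_ _+_ _*_ -_ 0# 1#
    0≢1     : ¬ (0# ≡ 1#)
    _⁻¹     : Carrier → Carrier
    ⁻¹-inverse : ∀ x → ¬ (x ≡ 0#) → (x * (x ⁻¹)) ≡ 1#
    elements : List Carrier
    complete : ∀ x → x ∈ elements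
    unique   : Unique elements

  order : ℕ
  order = length elements

module Geometry (F : FiniteField) where
  open FiniteField F

  isZero : Carrier → Bool
  isZero x = ⌊ x ≟ 0# ⌋

  -- a vector is normalised if it is nonzero and its first nonzero
  -- coordinate equals 1; normalised vectors are canonical
  -- representatives of the 1-dimensional subspaces (projective points)
  normalised : ∀ {n} → Vec Carrier n → Bool
  normalised []       = false
  normalised (x ∷ xs) = if isZero x then normalised xs else ⌊ x ≟ 1# ⌋

  Pt : ℕ → Set
  Pt n = Σ (Vec Carrier n) (λ v → T (normalised v))

  allVecs : ∀ n → List (Vec Carrier n)
  allVecs zero    = [] ∷ []
  allVecs (suc n) = concatMap (λ x → map (x ∷_) (allVecs n)) elements

  toPt : ∀ {n} → Vec Carrier n → Maybe (Pt n)
  toPt v with T? (normalised v)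
  ... | yes p = just (v , p)
  ... | no _  = nothing

  allPts : ∀ n → List (Pt n)
  allPts n = mapMaybe toPt (allVecs n)

  -- subsets of the point set of P_n (restrictions of P_n)
  PtSet : ℕ → Set
  PtSet n = Pt n → Bool

  _∈S_ : ∀ {n} → Pt n → PtSet n → Set
  p ∈S X = T (X p)

  _⊆S_ : ∀ {n} → PtSet n → PtSet n → Set
  X ⊆S Y = ∀ p → p ∈S X → p ∈S Y

  full : ∀ {n} → PtSet n
  full _ = true

  compl : ∀ {n} → PtSet n → PtSet n
  compl X p = not (X p)

  _∖_ : ∀ {n} → PtSet n → PtSet n → PtSet n
  (X ∖ Y) p = X p ∧ not (Y p)

  _∩_ : ∀ {n} → PtSet n → PtSet n → PtSet n
  (X ∩ Y) p = X p ∧ Y p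

  wt : ∀ {n} → (Pt n → ℕ) → PtSet n → ℕ
  wt {n} w X = sum (map (λ p → if X p then w p else 0) (allPts n))

  zeroV : ∀ {n} → Vec Carrier n
  zeroV = replicate _ 0#

  lincomb : ∀ {n} → List Carrier → List (Vec Carrier n) → Vec Carrier n
  lincomb (c ∷ cs) (v ∷ vs) = zipWith _+_ (V.map (c *_) v) (lincomb cs vs)
  lincomb _        _        = zeroV

  -- a list of points is independent in P_n iff its representative
  -- vectors are linearly independent (in particular, no repetitions)
  Indep : ∀ {n} → List (Pt n) → Set
  Indep ps = ∀ (cs : List Carrier) → length cs ≡ length ps →
             lincomb cs (map proj₁ ps) ≡ zeroV → All (_≡ 0#) cs

  Elem : ∀ {n} → PtSet n → Set
  Elem {n} S = Σ (Pt n) (λ p → p ∈S S)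

  record Iso {a b : ℕ} (S : PtSet a) (S' : PtSet b) : Set where
    field
      to    : Elem S → Elem S'
      from  : Elem S' → Elem S
      from∘to : ∀ x → from (to x) ≡ x
      to∘from : ∀ y → to (from y) ≡ y
      preservesIndep : ∀ (xs : List (Elem S)) →
        Indep (map proj₁ xs) ⇔ Indep (map (proj₁ ∘ to) xs)

  -- the matroid A_n = AG(n-1,q), realised as the restriction of P_n to
  -- the complement of the hyperplane {x₀ = 0}
  affine : ∀ {n} → PtSet n
  affine ([] , _)    = false
  affine (x ∷ _ , _) = not (isZero x)

  ContainsBasis : ∀ (r : ℕ) → PtSet r → Set
  ContainsBasis r S = Σ[ ps ∈ List (Pt r) ] (All (λ p → p ∈S S) ps × length ps ≡ r × Indep ps)

  -- C is a cocircuit of M = P_r|E (E of rank r): a minimal subset of E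
  -- meeting every basis of M, i.e. minimal with E∖C containing no basis
  IsCocircuit : ∀ (r : ℕ) → PtSet r → PtSet r → Set
  IsCocircuit r E C =
    C ⊆S E × ¬ ContainsBasis r (E ∖ C) ×
    (∀ (C' : PtSet r) → C' ⊆S C → ¬ ContainsBasis r (E ∖ C') → ∀ p → C' p ≡ C p)

  IsCogirth : ∀ (r : ℕ) → PtSet r → (Pt r → ℕ) → ℕ → Set
  IsCogirth r E w g =
    (Σ[ C ∈ PtSet r ] (IsCocircuit r E C × wt w C ≡ g)) ×
    (∀ C → IsCocircuit r E C → g ≤ wt w C)

  EqualityConditions : ∀ (r : ℕ) → PtSet r → (Pt r → ℕ) → Set
  EqualityConditions r E w =
    (Σ[ k ∈ ℕ ] (1 ≤ k × k < r × Iso (compl E) (full {k}) ×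
       (∀ (P : PtSet r) → Iso P (full {suc k}) → compl E ⊆S P →
          ∀ p p' → p ∈S (P ∩ E) → p' ∈S (P ∩ E) → w p ≡ w p'))) ×
    (∀ (N : PtSet r) → N ⊆S E → Iso N (affine {r}) →
       (order ∸ 1) ℕ.* wt w (E ∖ N) ≤ wt w N)

{-# OPTIONS --safe #-}
module Submission where

-- Write W⟨ f ⟩ for the weight of E off the hyperplane f = 0; the cogirth g is the least W⟨ f ⟩ with f ≠ 0.
-- Double counting over the functionals with f x ≠ 0 (there are d of them, independently of x) gives
--   q Σ W⟨ f ⟩ = d ((q − 1) w(E) + [x ∈ E] w x),
-- and x ∉ E yields the inequality.  In case of equality W⟨ f ⟩ = g as soon as f does not vanish on the
-- complement Q of E.  The identity at a point x of a line joining two points of Q then forces w x = 0, so Q is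
-- a subspace, and its instances at two points x, y collinear with a point of Q differ only by w x and w y,
-- so these agree.  A copy N of A_r is the complement of a hyperplane (Bose–Burton), which gives (iii).
-- Conversely, a hyperplane containing Q is dealt with by (iii); if it misses p ∈ Q, then by (ii) the weight
-- is invariant under translation by p, so the q translates of the hyperplane carry equal weight.

open import Defs
open import Algebra.Bundles using (CommutativeRing)
import Algebra.Properties.CommutativeSemigroup as CommutativeSemigroupProperties
import Algebra.Solver.Ring.NaturalCoefficients.Default as SemiringSolver
open import Data.Bool using (Bool; true; false; if_then_else_; T; not; _∧_)
import Data.Bool.Properties as Boolₚ
open import Data.Empty using (⊥; ⊥-elim)
open import Data.List using (List; []; _∷_; length; map; _++_; concatMap; mapMaybe; cartesianProductWith; filter)
open import Data.List.Membership.DecPropositional using () renaming (_∈?_ to member?)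
open import Data.List.Membership.Propositional using (_∈_; lose)
open import Data.List.Membership.Propositional.Properties using (∈-∃++; ∈-++⁻; ∈-++⁺ˡ; ∈-++⁺ʳ; ∈-map⁺; ∈-map⁻; ∈-filter⁺; ∈-filter⁻; ∈-cartesianProductWith⁺)
open import Data.List.Membership.Propositional.Properties.WithK using (unique∧set⇒bag)
open import Data.List.Properties using (length-++; length-map; map-∘; map-++; map-cong; map-id)
open import Data.List.Relation.Binary.BagAndSetEquality using (∼bag⇒↭)
open import Data.List.Relation.Binary.Permutation.Propositional.Properties using () renaming (map⁺ to ↭-map⁺)
open import Data.List.Relation.Unary.All as All using (All; []; _∷_)
import Data.List.Relation.Unary.All.Properties as Allₚ
open import Data.List.Relation.Unary.AllPairs using ([]; _∷_)
open import Data.List.Relation.Unary.Any as Any using (here; there)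
open import Data.List.Relation.Unary.Unique.Propositional using (Unique)
import Data.List.Relation.Unary.Unique.Propositional.Properties as Uniqueₚ
open import Data.Nat as ℕ using (ℕ; zero; suc; _≤_; _<_; z≤n; s≤s; _∸_)
open import Data.Nat.ListAction using (sum)
open import Data.Nat.ListAction.Properties using (sum-↭; sum-++)
import Data.Nat.Properties as ℕₚ
open import Data.Nat.Tactic.RingSolver using (solve-∀)
open import Data.Product using (Σ; ∃; _×_; _,_; proj₁; proj₂)
open import Data.Sum using (_⊎_; inj₁; inj₂)
open import Data.Unit using (tt)
open import Data.Vec as V using (Vec; []; _∷_; zipWith)
import Data.Vec.Properties as Vecₚ
open import Function using (_∘_; id)
open import Function.Bundles using (_⇔_; mk⇔; Equivalence)
open import Relation.Binary.Definitions using (DecidableEquality)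
open import Relation.Binary.PropositionalEquality using (_≡_; _≢_; refl; sym; trans; cong; cong₂; subst; subst₂; module ≡-Reasoning)
open import Relation.Nullary using (¬_; Dec; yes; no)
open import Relation.Nullary.Decidable using (⌊_⌋; T?; toWitness; fromWitness; map′; ¬?; _×-dec_; decidable-stable)

-- The statement reaches cocircuits only through bases and isomorphisms only through independence;
-- both have to be turned into linear algebra. For cocircuits the bridge is that a set of points
-- without a basis lies in a hyperplane: a cocircuit of weight g contains `C⟨ f ⟩` for some f ≠ 0,
-- and positivity of w gives g ≤ `W⟨ f ⟩` for all f ≠ 0. For isomorphisms no linear map is given.
-- That a copy of P_k is a subspace, and that the complement of a copy of A_r is one, is recovered
-- from rank bounds and from injections of a finite set into itself, which are onto. The ratio (q -
-- 1)/q is the share of all vectors lying off the kernel of a nonzero functional. It enters twice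
-- through `equidistribution`, once with the functionals as summation variable and once, in the
-- converse, with the vectors. All counts stay in ℕ: fractions are cleared by factors q and q - 1,
-- and differences by adding terms to both sides.

module _ {A : Set} where

  -- Pigeonhole and sums over duplicate-free lists

  unique-⊆⇒length≤ : {xs ys : List A} → Unique xs → (∀ {x} → x ∈ xs → x ∈ ys) → length xs ≤ length ys
  unique-⊆⇒length≤ {[]} _ _ = z≤n
  unique-⊆⇒length≤ {x ∷ xs} (x∉xs ∷ u) sub with ∈-∃++ (sub (here refl))
  ... | as , bs , refl = subst (suc (length xs) ≤_) (sym eq) (s≤s (unique-⊆⇒length≤ u sub′))
    where
    eq : length (as ++ x ∷ bs) ≡ suc (length (as ++ bs))
    eq = trans (length-++ as) (trans (ℕₚ.+-suc _ _) (cong suc (sym (length-++ as))))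
    sub′ : ∀ {y} → y ∈ xs → y ∈ as ++ bs
    sub′ y∈ with ∈-++⁻ as (sub (there y∈))
    ... | inj₁ y∈as = ∈-++⁺ˡ y∈as
    ... | inj₂ (here refl) = ⊥-elim (All.lookup x∉xs y∈ refl)
    ... | inj₂ (there y∈bs) = ∈-++⁺ʳ as y∈bs

  -- A missed y would make `y ∷ map f xs` a duplicate-free list longer than the complete list `xs`.
  -- This finite counting replaces linearity wherever only a matroid isomorphism is known.
  injective⇒surjective : DecidableEquality A → (xs : List A) → Unique xs → (∀ x → x ∈ xs) →
    (f : A → A) → (∀ {x y} → f x ≡ f y → x ≡ y) → ∀ y → ∃ λ x → f x ≡ y
  injective⇒surjective _≟_ xs u c f inj y with member? _≟_ y (map f xs)
  ... | yes y∈ = let x , _ , eq = ∈-map⁻ f y∈ in x , sym eq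
  ... | no y∉ = ⊥-elim (ℕₚ.<-irrefl refl (subst (λ n → suc n ≤ length xs) (length-map f xs)
                  (unique-⊆⇒length≤ (All.tabulate (λ z∈ → λ { refl → y∉ z∈ }) ∷ Uniqueₚ.map⁺ inj u) (λ {x} _ → c x))))

  ∑ : List A → (A → ℕ) → ℕ
  ∑ xs f = sum (map f xs)

  ∑-cong : ∀ xs {f g : A → ℕ} → (∀ x → f x ≡ g x) → ∑ xs f ≡ ∑ xs g
  ∑-cong [] _ = refl
  ∑-cong (x ∷ xs) h = cong₂ ℕ._+_ (h x) (∑-cong xs h)

  ∑-+ : ∀ xs (f g : A → ℕ) → ∑ xs (λ x → f x ℕ.+ g x) ≡ ∑ xs f ℕ.+ ∑ xs g
  ∑-+ [] _ _ = refl
  ∑-+ (x ∷ xs) f g rewrite ∑-+ xs f g = interchange (f x) (g x) (∑ xs f) (∑ xs g)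
    where open CommutativeSemigroupProperties ℕₚ.+-commutativeSemigroup using (interchange)

  ∑-*ˡ : ∀ xs c (f : A → ℕ) → ∑ xs (λ x → c ℕ.* f x) ≡ c ℕ.* ∑ xs f
  ∑-*ˡ [] c _ = sym (ℕₚ.*-zeroʳ c)
  ∑-*ˡ (x ∷ xs) c f = trans (cong (c ℕ.* f x ℕ.+_) (∑-*ˡ xs c f)) (sym (ℕₚ.*-distribˡ-+ c (f x) (∑ xs f)))

  ∑-*ʳ : ∀ xs (f : A → ℕ) c → ∑ xs (λ x → f x ℕ.* c) ≡ ∑ xs f ℕ.* c
  ∑-*ʳ xs f c = trans (∑-cong xs (λ x → ℕₚ.*-comm (f x) c)) (trans (∑-*ˡ xs c f) (ℕₚ.*-comm c _))

  ∑-zero : ∀ xs → ∑ xs (λ _ → 0) ≡ 0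
  ∑-zero [] = refl
  ∑-zero (_ ∷ xs) = ∑-zero xs

  ∑-const : ∀ xs c → ∑ xs (λ _ → c) ≡ length xs ℕ.* c
  ∑-const [] c = refl
  ∑-const (_ ∷ xs) c = cong (c ℕ.+_) (∑-const xs c)

  ∑-mono : ∀ xs {f g : A → ℕ} → (∀ x → f x ≤ g x) → ∑ xs f ≤ ∑ xs g
  ∑-mono [] _ = z≤n
  ∑-mono (x ∷ xs) h = ℕₚ.+-mono-≤ (h x) (∑-mono xs h)

  -- The slack of the sums is the sum of the termwise slacks, so none is left anywhere. This is what
  -- turns one numerical equality into information about each functional or point.
  ∑-tight : ∀ xs {f g : A → ℕ} → (∀ x → f x ≤ g x) → ∑ xs g ≤ ∑ xs f → ∀ {x} → x ∈ xs → f x ≡ g x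
  ∑-tight (x ∷ xs) {f} {g} h le (here refl) =
    ℕₚ.≤-antisym (h x) (ℕₚ.+-cancelʳ-≤ (∑ xs g) (g x) (f x) (ℕₚ.≤-trans le (ℕₚ.+-monoʳ-≤ (f x) (∑-mono xs h))))
  ∑-tight (x ∷ xs) {f} {g} h le (there i) =
    ∑-tight xs h (ℕₚ.+-cancelˡ-≤ (g x) (∑ xs g) (∑ xs f) (ℕₚ.≤-trans le (ℕₚ.+-monoˡ-≤ (∑ xs f) (h x)))) i

  ∑-++ : ∀ xs ys (f : A → ℕ) → ∑ (xs ++ ys) f ≡ ∑ xs f ℕ.+ ∑ ys f
  ∑-++ xs ys f = trans (cong sum (map-++ f xs ys)) (sum-++ (map f xs) (map f ys))

  ∑-supported : ∀ xs (f : A → ℕ) a → Unique xs → a ∈ xs → (∀ x → x ≢ a → f x ≡ 0) → ∑ xs f ≡ f a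
  ∑-supported (x ∷ xs) f a (x∉ ∷ u) (here refl) z = trans (cong (f a ℕ.+_) (vanish xs x∉)) (ℕₚ.+-identityʳ _)
    where
    vanish : ∀ ys → All (a ≢_) ys → ∑ ys f ≡ 0
    vanish [] _ = refl
    vanish (y ∷ ys) (p ∷ ps) = cong₂ ℕ._+_ (z y (p ∘ sym)) (vanish ys ps)
  ∑-supported (x ∷ xs) f a (x∉ ∷ u) (there i) z =
    cong₂ ℕ._+_ (z x (All.lookup x∉ i)) (∑-supported xs f a u i z)

  ∑-reindex : ∀ xs → Unique xs → (∀ x → x ∈ xs) → DecidableEquality A → (g : A → A) →
    (∀ {x y} → g x ≡ g y → x ≡ y) → (f : A → ℕ) → ∑ xs (λ x → f (g x)) ≡ ∑ xs f
  ∑-reindex xs u c _≟_ g inj f = trans (cong sum (map-∘ xs)) (sum-↭ (↭-map⁺ f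
    (∼bag⇒↭ (unique∧set⇒bag (Uniqueₚ.map⁺ inj u) u (λ {z} → mk⇔ (λ _ → c z) (λ _ →
      let x , eq = injective⇒surjective _≟_ xs u c g inj z in subst (_∈ map g xs) eq (∈-map⁺ g (c x))))))))

∑-swap : {A B : Set} (xs : List A) (ys : List B) (f : A → B → ℕ) →
  ∑ xs (λ x → ∑ ys (f x)) ≡ ∑ ys (λ y → ∑ xs (λ x → f x y))
∑-swap [] ys f = sym (∑-zero ys)
∑-swap (x ∷ xs) ys f = trans (cong (∑ ys (f x) ℕ.+_) (∑-swap xs ys f)) (sym (∑-+ ys (f x) _))

∑-concatMap : {A B : Set} (xs : List A) (g : A → List B) (f : B → ℕ) → ∑ (concatMap g xs) f ≡ ∑ xs (λ x → ∑ (g x) f)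
∑-concatMap [] g f = refl
∑-concatMap (x ∷ xs) g f = trans (∑-++ (g x) (concatMap g xs) f) (cong (∑ (g x) f ℕ.+_) (∑-concatMap xs g f))

∑-map : {A B : Set} (xs : List A) (g : A → B) (f : B → ℕ) → ∑ (map g xs) f ≡ ∑ xs (λ x → f (g x))
∑-map xs g f = cong sum (sym (map-∘ xs))

-- Truth values as numbers

if-T : ∀ {b} {x y : ℕ} → T b → (if b then x else y) ≡ x
if-T {true} _ = refl

if-¬T : ∀ {b} {x y : ℕ} → ¬ T b → (if b then x else y) ≡ y
if-¬T {false} _ = refl
if-¬T {true} nt = ⊥-elim (nt _)

⟦_⟧ : Bool → ℕ
⟦ true ⟧ = 1
⟦ false ⟧ = 0

⟦⟧-split : ∀ b → ⟦ not b ⟧ ℕ.+ ⟦ b ⟧ ≡ 1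
⟦⟧-split true = refl
⟦⟧-split false = refl

⌊⌋-cong : ∀ {P Q : Set} (P? : Dec P) (Q? : Dec Q) → (P → Q) → (Q → P) → ⌊ P? ⌋ ≡ ⌊ Q? ⌋
⌊⌋-cong (yes _) (yes _) _ _ = refl
⌊⌋-cong (no _) (no _) _ _ = refl
⌊⌋-cong (yes p) (no nq) f _ = ⊥-elim (nq (f p))
⌊⌋-cong (no np) (yes q) _ g = ⊥-elim (np (g q))

⟦⌊⌋⟧-yes : ∀ {P : Set} (P? : Dec P) → P → ⟦ ⌊ P? ⌋ ⟧ ≡ 1
⟦⌊⌋⟧-yes (yes _) _ = refl
⟦⌊⌋⟧-yes (no np) p = ⊥-elim (np p)

⟦⌊⌋⟧-no : ∀ {P : Set} (P? : Dec P) → ¬ P → ⟦ ⌊ P? ⌋ ⟧ ≡ 0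
⟦⌊⌋⟧-no (yes p) np = ⊥-elim (np p)
⟦⌊⌋⟧-no (no _) _ = refl

-- This is X = Y - Y/q with the fraction cleared: Z is the q-th part taken by one level set and X is
-- what the others take.
complement-share : ∀ q X Z {Y} → 1 ≤ q → X ℕ.+ Z ≡ Y → q ℕ.* Z ≡ Y → q ℕ.* X ≡ (q ∸ 1) ℕ.* Y
complement-share (suc m) X Z {Y} _ refl qZ = ℕₚ.+-cancelʳ-≡ (X ℕ.+ Z) _ _ (begin
  suc m ℕ.* X ℕ.+ (X ℕ.+ Z) ≡⟨ cong (suc m ℕ.* X ℕ.+_) qZ ⟨
  suc m ℕ.* X ℕ.+ suc m ℕ.* Z ≡⟨ ℕₚ.*-distribˡ-+ (suc m) X Z ⟨
  (X ℕ.+ Z) ℕ.+ m ℕ.* (X ℕ.+ Z) ≡⟨ ℕₚ.+-comm (X ℕ.+ Z) _ ⟩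
  m ℕ.* (X ℕ.+ Z) ℕ.+ (X ℕ.+ Z) ∎)
  where open ≡-Reasoning

T-∧⁺ : ∀ {a b} → T a → T b → T (a ∧ b)
T-∧⁺ {true} _ t = t

T-∧ˡ : ∀ {a b} → T (a ∧ b) → T a
T-∧ˡ {true} _ = _

T-∧ʳ : ∀ {a b} → T (a ∧ b) → T b
T-∧ʳ {true} t = t

T-not⁺ : ∀ {a} → ¬ T a → T (not a)
T-not⁺ {true} n = ⊥-elim (n _)
T-not⁺ {false} _ = _

T-not⁻ : ∀ {a} → T (not a) → ¬ T a
T-not⁻ {false} _ ()

T-ext : ∀ {a b} → (T a → T b) → (T b → T a) → a ≡ b
T-ext {true} {true} _ _ = refl
T-ext {false} {false} _ _ = refl
T-ext {true} {false} f _ = ⊥-elim (f _)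
T-ext {false} {true} _ g = ⊥-elim (g _)

module ProjectiveGeometry (F : FiniteField) where
  open FiniteField F
  open Geometry F

  -- Field arithmetic

  commutativeRing : CommutativeRing _ _
  commutativeRing = record { isCommutativeRing = isCommutativeRing }

  open CommutativeRing commutativeRing using
    ( +-assoc; +-comm; +-identityˡ; +-identityʳ; -‿inverseʳ; *-assoc; *-comm; *-identityˡ; *-identityʳ
    ; distribˡ; distribʳ; zeroˡ; zeroʳ; commutativeSemiring)
  open SemiringSolver commutativeSemiring using (solve; _:+_; _:*_; _:=_)

  ⁻¹-inverseˡ : ∀ {x} → x ≢ 0# → ((x ⁻¹) * x) ≡ 1#
  ⁻¹-inverseˡ {x} nz = trans (*-comm _ _) (⁻¹-inverse x nz)

  *-cancelˡ-zero : ∀ {x y} → x ≢ 0# → (x * y) ≡ 0# → y ≡ 0#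
  *-cancelˡ-zero {x} {y} nz eq = begin
    y ≡⟨ *-identityˡ y ⟨
    1# * y ≡⟨ cong (_* y) (⁻¹-inverseˡ nz) ⟨
    ((x ⁻¹) * x) * y ≡⟨ *-assoc _ _ _ ⟩
    (x ⁻¹) * (x * y) ≡⟨ cong ((x ⁻¹) *_) eq ⟩
    (x ⁻¹) * 0# ≡⟨ zeroʳ _ ⟩
    0# ∎
    where open ≡-Reasoning

  *-≢0 : ∀ {x y} → x ≢ 0# → y ≢ 0# → (x * y) ≢ 0#
  *-≢0 nx ny eq = ny (*-cancelˡ-zero nx eq)

  ⁻¹-≢0 : ∀ {x} → x ≢ 0# → (x ⁻¹) ≢ 0#
  ⁻¹-≢0 {x} nx eq = 0≢1 (trans (sym (zeroˡ x)) (trans (cong (_* x) (sym eq)) (⁻¹-inverseˡ nx)))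

  1≢0 : 1# ≢ 0#
  1≢0 = 0≢1 ∘ sym

  -≡0 : ∀ {x} → (- x) ≡ 0# → x ≡ 0#
  -≡0 {x} eq = trans (sym (+-identityʳ x)) (trans (cong (x +_) (sym eq)) (-‿inverseʳ x))

  +-injectiveˡ : ∀ c {x y} → (x + c) ≡ (y + c) → x ≡ y
  +-injectiveˡ c {x} {y} eq = trans (sym (undo x)) (trans (cong (_+ (- c)) eq) (undo y))
    where
    undo : ∀ z → ((z + c) + (- c)) ≡ z
    undo z = trans (+-assoc z c _) (trans (cong (z +_) (-‿inverseʳ c)) (+-identityʳ z))

  -- Vectors and functionals

  Vector : ℕ → Set
  Vector = Vec Carrier

  infixl 6 _⊕_
  infixr 7 _⊙_

  _⊕_ : ∀ {n} → Vector n → Vector n → Vector n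
  _⊕_ = zipWith _+_

  _⊙_ : ∀ {n} → Carrier → Vector n → Vector n
  c ⊙ v = V.map (c *_) v

  _≟ᵥ_ : ∀ {n} → DecidableEquality (Vector n)
  _≟ᵥ_ = Vecₚ.≡-dec _≟_

  ⊕-comm : ∀ {n} (u v : Vector n) → u ⊕ v ≡ v ⊕ u
  ⊕-comm = Vecₚ.zipWith-comm +-comm

  ⊕-assoc : ∀ {n} (u v w : Vector n) → (u ⊕ v) ⊕ w ≡ u ⊕ (v ⊕ w)
  ⊕-assoc = Vecₚ.zipWith-assoc +-assoc

  ⊕-identityˡ : ∀ {n} (v : Vector n) → zeroV ⊕ v ≡ v
  ⊕-identityˡ = Vecₚ.zipWith-identityˡ +-identityˡ

  ⊕-identityʳ : ∀ {n} (v : Vector n) → v ⊕ zeroV ≡ v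
  ⊕-identityʳ = Vecₚ.zipWith-identityʳ +-identityʳ

  ⊙-distribˡ : ∀ {n} c (u v : Vector n) → c ⊙ (u ⊕ v) ≡ c ⊙ u ⊕ c ⊙ v
  ⊙-distribˡ c [] [] = refl
  ⊙-distribˡ c (x ∷ u) (y ∷ v) = cong₂ _∷_ (distribˡ c x y) (⊙-distribˡ c u v)

  ⊙-distribʳ : ∀ {n} c d (v : Vector n) → (c + d) ⊙ v ≡ c ⊙ v ⊕ d ⊙ v
  ⊙-distribʳ c d [] = refl
  ⊙-distribʳ c d (x ∷ v) = cong₂ _∷_ (distribʳ x c d) (⊙-distribʳ c d v)

  ⊙-⊙ : ∀ {n} c d (v : Vector n) → c ⊙ (d ⊙ v) ≡ (c * d) ⊙ v
  ⊙-⊙ c d [] = refl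
  ⊙-⊙ c d (x ∷ v) = cong₂ _∷_ (sym (*-assoc c d x)) (⊙-⊙ c d v)

  1⊙ : ∀ {n} (v : Vector n) → 1# ⊙ v ≡ v
  1⊙ [] = refl
  1⊙ (x ∷ v) = cong₂ _∷_ (*-identityˡ x) (1⊙ v)

  0⊙ : ∀ {n} (v : Vector n) → 0# ⊙ v ≡ zeroV
  0⊙ [] = refl
  0⊙ (x ∷ v) = cong₂ _∷_ (zeroˡ x) (0⊙ v)

  ⊙-zeroV : ∀ {n} c → c ⊙ zeroV {n} ≡ zeroV
  ⊙-zeroV {zero} c = refl
  ⊙-zeroV {suc n} c = cong₂ _∷_ (zeroʳ c) (⊙-zeroV c)

  ⊕-inverseʳ : ∀ {n} (v : Vector n) → v ⊕ (- 1#) ⊙ v ≡ zeroV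
  ⊕-inverseʳ v = begin
    v ⊕ (- 1#) ⊙ v ≡⟨ cong (_⊕ (- 1#) ⊙ v) (1⊙ v) ⟨
    1# ⊙ v ⊕ (- 1#) ⊙ v ≡⟨ ⊙-distribʳ 1# (- 1#) v ⟨
    (1# + (- 1#)) ⊙ v ≡⟨ cong (_⊙ v) (-‿inverseʳ 1#) ⟩
    0# ⊙ v ≡⟨ 0⊙ v ⟩
    zeroV ∎
    where open ≡-Reasoning

  ⊕-inverse-unique : ∀ {n} (u v : Vector n) → u ⊕ v ≡ zeroV → u ≡ (- 1#) ⊙ v
  ⊕-inverse-unique u v eq = begin
    u ≡⟨ ⊕-identityʳ u ⟨
    u ⊕ zeroV ≡⟨ cong (u ⊕_) (⊕-inverseʳ v) ⟨
    u ⊕ (v ⊕ (- 1#) ⊙ v) ≡⟨ ⊕-assoc u v _ ⟨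
    (u ⊕ v) ⊕ (- 1#) ⊙ v ≡⟨ cong (_⊕ (- 1#) ⊙ v) eq ⟩
    zeroV ⊕ (- 1#) ⊙ v ≡⟨ ⊕-identityˡ _ ⟩
    (- 1#) ⊙ v ∎
    where open ≡-Reasoning

  ⊕-difference : ∀ {n} (u v : Vector n) → u ⊕ (- 1#) ⊙ v ≡ zeroV → u ≡ v
  ⊕-difference u v eq = trans (⊕-inverse-unique u _ eq) (sym (⊕-inverse-unique v ((- 1#) ⊙ v) (⊕-inverseʳ v)))

  ⊕-cancelʳ : ∀ {n} (w : Vector n) {u v} → u ⊕ w ≡ v ⊕ w → u ≡ v
  ⊕-cancelʳ w {u} {v} eq = trans (sym (undo u)) (trans (cong (_⊕ (- 1#) ⊙ w) eq) (undo v))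
    where
    undo : ∀ z → (z ⊕ w) ⊕ (- 1#) ⊙ w ≡ z
    undo z = trans (⊕-assoc z w _) (trans (cong (z ⊕_) (⊕-inverseʳ w)) (⊕-identityʳ z))

  ⊙-inverse : ∀ {n c} → c ≢ 0# → (v : Vector n) → (c ⁻¹) ⊙ (c ⊙ v) ≡ v
  ⊙-inverse {c = c} nc v = trans (⊙-⊙ _ c v) (trans (cong (_⊙ v) (⁻¹-inverseˡ nc)) (1⊙ v))

  ⊙-cancel : ∀ {n c} → c ≢ 0# → {u v : Vector n} → c ⊙ u ≡ c ⊙ v → u ≡ v
  ⊙-cancel {c = c} nc {u} {v} eq = trans (sym (⊙-inverse nc u)) (trans (cong ((c ⁻¹) ⊙_) eq) (⊙-inverse nc v))

  ⊙-≢0 : ∀ {n c} → c ≢ 0# → {v : Vector n} → v ≢ zeroV → c ⊙ v ≢ zeroV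
  ⊙-≢0 {c = c} nc nv eq = nv (⊙-cancel nc (trans eq (sym (⊙-zeroV c))))

  solve-for : ∀ {n c} → c ≢ 0# → (v w : Vector n) → c ⊙ v ⊕ w ≡ zeroV → v ≡ ((c ⁻¹) * (- 1#)) ⊙ w
  solve-for {c = c} nc v w eq = trans (sym (⊙-inverse nc v))
    (trans (cong ((c ⁻¹) ⊙_) (⊕-inverse-unique (c ⊙ v) w eq)) (⊙-⊙ _ _ w))

  -- Functionals are encoded as vectors acting by `dot`. Sums over functionals are thereby sums over
  -- `allVecs`, and vectors and functionals can exchange roles.
  dot : ∀ {n} → Vector n → Vector n → Carrier
  dot [] [] = 0#
  dot (x ∷ u) (y ∷ v) = (x * y) + dot u v

  dot-comm : ∀ {n} (u v : Vector n) → dot u v ≡ dot v u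
  dot-comm [] [] = refl
  dot-comm (x ∷ u) (y ∷ v) = cong₂ _+_ (*-comm x y) (dot-comm u v)

  dot-⊕ʳ : ∀ {n} (f u v : Vector n) → dot f (u ⊕ v) ≡ (dot f u + dot f v)
  dot-⊕ʳ [] [] [] = sym (+-identityʳ 0#)
  dot-⊕ʳ (a ∷ f) (x ∷ u) (y ∷ v) = trans (cong ((a * (x + y)) +_) (dot-⊕ʳ f u v))
    (solve 5 (λ a x y s t → a :* (x :+ y) :+ (s :+ t) := (a :* x :+ s) :+ (a :* y :+ t)) refl a x y _ _)

  dot-⊙ʳ : ∀ {n} (f : Vector n) c v → dot f (c ⊙ v) ≡ (c * dot f v)
  dot-⊙ʳ [] c [] = sym (zeroʳ c)
  dot-⊙ʳ (a ∷ f) c (x ∷ v) = trans (cong ((a * (c * x)) +_) (dot-⊙ʳ f c v))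
    (solve 4 (λ a c x s → a :* (c :* x) :+ c :* s := c :* (a :* x :+ s)) refl a c x _)

  dot-zeroʳ : ∀ {n} (f : Vector n) → dot f zeroV ≡ 0#
  dot-zeroʳ [] = refl
  dot-zeroʳ (a ∷ f) = trans (cong₂ _+_ (zeroʳ a) (dot-zeroʳ f)) (+-identityʳ 0#)

  dot-⊕ˡ : ∀ {n} (f g v : Vector n) → dot (f ⊕ g) v ≡ (dot f v + dot g v)
  dot-⊕ˡ f g v = trans (dot-comm _ v) (trans (dot-⊕ʳ v f g) (cong₂ _+_ (dot-comm v f) (dot-comm v g)))

  dot-⊙ˡ : ∀ {n} c (f v : Vector n) → dot (c ⊙ f) v ≡ (c * dot f v)
  dot-⊙ˡ c f v = trans (dot-comm _ v) (trans (dot-⊙ʳ v c f) (cong (c *_) (dot-comm v f)))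

  dual : ∀ {n} (v : Vector n) → v ≢ zeroV → ∃ λ f → dot f v ≡ 1#
  dual [] nv = ⊥-elim (nv refl)
  dual (x ∷ v) nv with x ≟ 0#
  ... | yes refl = let f , eq = dual v (nv ∘ cong (0# ∷_)) in
        0# ∷ f , trans (cong₂ _+_ (zeroʳ 0#) eq) (+-identityˡ 1#)
  ... | no nx = (x ⁻¹) ∷ zeroV , trans (cong₂ _+_ (⁻¹-inverseˡ nx) (trans (dot-comm zeroV v) (dot-zeroʳ v))) (+-identityʳ 1#)

  -- With e·x = 1, any functional h′ not killing y − (e·y)x gives h = h′ − (h′·x)e, which kills x and not y.
  separate : ∀ {n} (x y : Vector n) → x ≢ zeroV → (∃ λ h → dot h x ≡ 0# × dot h y ≡ 1#) ⊎ (∃ λ c → y ≡ c ⊙ x)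
  separate x y nx with dual x nx
  ... | e , ex with (y ⊕ (- 1#) ⊙ (dot e y ⊙ x)) ≟ᵥ zeroV
  ... | yes eq = inj₂ (dot e y , ⊕-difference y (dot e y ⊙ x) eq)
  ... | no ne with dual _ ne
  ... | h′ , h′y = inj₁ (h , hx , trans hy h′y)
    where
    open ≡-Reasoning
    m = - 1#
    h = h′ ⊕ (m * dot h′ x) ⊙ e
    hx : dot h x ≡ 0#
    hx = begin
      dot h x ≡⟨ dot-⊕ˡ h′ _ x ⟩
      dot h′ x + dot ((m * dot h′ x) ⊙ e) x ≡⟨ cong (dot h′ x +_) (trans (dot-⊙ˡ _ e x) (cong ((m * dot h′ x) *_) ex)) ⟩
      dot h′ x + ((m * dot h′ x) * 1#) ≡⟨ solve 3 (λ d m o → d :+ (m :* d) :* o := d :+ d :* (m :* o)) refl (dot h′ x) m 1# ⟩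
      dot h′ x + (dot h′ x * (m * 1#)) ≡⟨ cong₂ _+_ (sym (*-identityʳ _)) (cong (dot h′ x *_) (*-identityʳ m)) ⟩
      (dot h′ x * 1#) + (dot h′ x * m) ≡⟨ distribˡ _ 1# m ⟨
      dot h′ x * (1# + m) ≡⟨ cong (dot h′ x *_) (-‿inverseʳ 1#) ⟩
      dot h′ x * 0# ≡⟨ zeroʳ _ ⟩
      0# ∎
    hy : dot h y ≡ dot h′ (y ⊕ m ⊙ (dot e y ⊙ x))
    hy = begin
      dot h y ≡⟨ dot-⊕ˡ h′ _ y ⟩
      dot h′ y + dot ((m * dot h′ x) ⊙ e) y ≡⟨ cong (dot h′ y +_) (dot-⊙ˡ _ e y) ⟩
      dot h′ y + ((m * dot h′ x) * dot e y) ≡⟨ cong (dot h′ y +_) (solve 3 (λ m a b → (m :* a) :* b := m :* (b :* a)) refl m _ _) ⟩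
      dot h′ y + (m * (dot e y * dot h′ x)) ≡⟨ cong (dot h′ y +_) (trans (dot-⊙ʳ h′ m _) (cong (m *_) (dot-⊙ʳ h′ _ x))) ⟨
      dot h′ y + dot h′ (m ⊙ (dot e y ⊙ x)) ≡⟨ dot-⊕ʳ h′ y _ ⟨
      dot h′ (y ⊕ m ⊙ (dot e y ⊙ x)) ∎

  -- Projective points

  zeroV-not-normalised : ∀ n → ¬ T (normalised (zeroV {n}))
  zeroV-not-normalised (suc n) t with 0# ≟ 0#
  ... | yes _ = zeroV-not-normalised n t
  ... | no n0 = n0 refl

  point≢0 : ∀ {n} (p : Pt n) → proj₁ p ≢ zeroV
  point≢0 {n} (_ , t) refl = zeroV-not-normalised n t

  Pt-≡ : ∀ {n} {p p′ : Pt n} → proj₁ p ≡ proj₁ p′ → p ≡ p′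
  Pt-≡ {p = _ , t} {_ , t′} refl = cong (_ ,_) (Boolₚ.T-irrelevant t t′)

  _≟ₚ_ : ∀ {n} → DecidableEquality (Pt n)
  p ≟ₚ p′ = map′ Pt-≡ (cong proj₁) (proj₁ p ≟ᵥ proj₁ p′)

  normalised-0∷ : ∀ {n} (v : Vector n) → T (normalised v) → T (normalised (0# ∷ v))
  normalised-0∷ v t with 0# ≟ 0#
  ... | yes _ = t
  ... | no n0 = ⊥-elim (n0 refl)

  normalised-1∷ : ∀ {n} (v : Vector n) → T (normalised (1# ∷ v))
  normalised-1∷ v with 1# ≟ 0#
  ... | yes eq = ⊥-elim (0≢1 (sym eq))
  ... | no _ = fromWitness refl

  -- A nonzero scalar leaves the position of the first nonzero coordinate unchanged, and that
  -- coordinate is 1 in both vectors.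
  normalised-scalar : ∀ {n c} {u v : Vector n} → c ≢ 0# → T (normalised u) → T (normalised v) → c ⊙ u ≡ v → c ≡ 1#
  normalised-scalar {c = c} {x ∷ u} {.(c * x) ∷ .(c ⊙ u)} nc tu tv refl with x ≟ 0# | (c * x) ≟ 0#
  ... | yes _ | yes _ = normalised-scalar {u = u} nc tu tv refl
  ... | yes refl | no ne = ⊥-elim (ne (zeroʳ c))
  ... | no nx | yes eq = ⊥-elim (*-≢0 nc nx eq)
  ... | no nx | no _ = trans (sym (*-identityʳ c)) (trans (cong (c *_) (sym (toWitness tu))) (toWitness tv))

  infix 4 _∼_
  -- Homogeneous coordinates: v represents p. Keeping the scalar as data avoids renormalising after
  -- every linear operation.
  _∼_ : ∀ {n} → Vector n → Pt n → Set
  v ∼ p = ∃ λ c → c ≢ 0# × v ≡ c ⊙ proj₁ p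

  pointOf : ∀ {n} (v : Vector n) → v ≢ zeroV → ∃ λ p → v ∼ p
  pointOf [] nv = ⊥-elim (nv refl)
  pointOf (x ∷ v) nv with x ≟ 0#
  ... | yes refl = let (p , t) , c , nc , eq = pointOf v (nv ∘ cong (0# ∷_)) in
        (0# ∷ p , normalised-0∷ p t) , c , nc , cong₂ _∷_ (sym (zeroʳ c)) eq
  ... | no nx = (1# ∷ (x ⁻¹) ⊙ v , normalised-1∷ ((x ⁻¹) ⊙ v)) , x , nx , cong₂ _∷_ (sym (*-identityʳ x))
        (sym (trans (⊙-⊙ x _ v) (trans (cong (_⊙ v) (⁻¹-inverse x nx)) (1⊙ v))))

  ∼-refl : ∀ {n} (p : Pt n) → proj₁ p ∼ p
  ∼-refl p = 1# , 1≢0 , sym (1⊙ _)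

  ∼-⊙ : ∀ {n c} {v : Vector n} {p} → c ≢ 0# → v ∼ p → c ⊙ v ∼ p
  ∼-⊙ {c = c} nc (d , nd , refl) = c * d , *-≢0 nc nd , ⊙-⊙ c d _

  ∼-unique : ∀ {n} {v : Vector n} {p p′} → v ∼ p → v ∼ p′ → p ≡ p′
  ∼-unique {p = p} {p′} (c , nc , refl) (d , nd , eq) = Pt-≡ (trans (sym (1⊙ _)) (trans (cong (_⊙ proj₁ p) (sym e1)) e))
    where
    e : ((d ⁻¹) * c) ⊙ proj₁ p ≡ proj₁ p′
    e = trans (sym (⊙-⊙ _ c _)) (trans (cong ((d ⁻¹) ⊙_) eq) (⊙-inverse nd _))
    e1 : ((d ⁻¹) * c) ≡ 1#
    e1 = normalised-scalar {u = proj₁ p} (*-≢0 (⁻¹-≢0 nd) nc) (proj₂ p) (proj₂ p′) e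

  ∼-≢0 : ∀ {n} {v : Vector n} {p} → v ∼ p → v ≢ zeroV
  ∼-≢0 {p = p} (c , nc , refl) = ⊙-≢0 nc (point≢0 p)

  ∼-sym : ∀ {n} {v : Vector n} {p} → v ∼ p → ∃ λ c → c ≢ 0# × proj₁ p ≡ c ⊙ v
  ∼-sym (c , nc , refl) = c ⁻¹ , ⁻¹-≢0 nc , sym (⊙-inverse nc _)

  -- Enumeration of vectors and points

  q : ℕ
  q = order

  1<q : 1 < q
  1<q = unique-⊆⇒length≤ {xs = 0# ∷ 1# ∷ []} ((0≢1 ∷ []) ∷ [] ∷ []) (λ {x} _ → complete x)

  allVecs-suc : ∀ n → allVecs (suc n) ≡ cartesianProductWith _∷_ elements (allVecs n)
  allVecs-suc n = go elements
    where
    go : ∀ xs → concatMap (λ x → map (x ∷_) (allVecs n)) xs ≡ cartesianProductWith _∷_ xs (allVecs n)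
    go [] = refl
    go (x ∷ xs) = cong (map (x ∷_) (allVecs n) ++_) (go xs)

  allVecs-complete : ∀ {n} (v : Vector n) → v ∈ allVecs n
  allVecs-complete [] = here refl
  allVecs-complete {suc n} (x ∷ v) = subst (x ∷ v ∈_) (sym (allVecs-suc n))
    (∈-cartesianProductWith⁺ _∷_ (complete x) (allVecs-complete v))

  allVecs-unique : ∀ n → Unique (allVecs n)
  allVecs-unique zero = [] ∷ []
  allVecs-unique (suc n) = subst Unique (sym (allVecs-suc n))
    (Uniqueₚ.cartesianProductWith⁺ _∷_ Vecₚ.∷-injective unique (allVecs-unique n))

  ∈-mapMaybe-toPt : ∀ {n} (p : Pt n) vs → proj₁ p ∈ vs → p ∈ mapMaybe toPt vs
  ∈-mapMaybe-toPt p (v ∷ vs) (here refl) with T? (normalised (proj₁ p))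
  ... | yes _ = here (Pt-≡ refl)
  ... | no nt = ⊥-elim (nt (proj₂ p))
  ∈-mapMaybe-toPt p (v ∷ vs) (there i) with T? (normalised v)
  ... | yes _ = there (∈-mapMaybe-toPt p vs i)
  ... | no _ = ∈-mapMaybe-toPt p vs i

  allPts-complete : ∀ {n} (p : Pt n) → p ∈ allPts n
  allPts-complete p = ∈-mapMaybe-toPt p _ (allVecs-complete (proj₁ p))

  allPts-unique : ∀ n → Unique (allPts n)
  allPts-unique n = go (allVecs n) (allVecs-unique n)
    where
    fresh : ∀ v t vs → All (v ≢_) vs → All (_≢_ {A = Pt n} (v , t)) (mapMaybe toPt vs)
    fresh v t [] [] = []
    fresh v t (u ∷ us) (n ∷ ns) with T? (normalised u)
    ... | yes _ = (n ∘ cong proj₁) ∷ fresh v t us ns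
    ... | no _ = fresh v t us ns
    go : ∀ vs → Unique vs → Unique (mapMaybe toPt vs)
    go [] [] = []
    go (v ∷ vs) (v∉ ∷ u) with T? (normalised v)
    ... | yes t = fresh v t vs v∉ ∷ go vs u
    ... | no _ = go vs u

  ∑-allPts : ∀ {n} (φ : Vector n → ℕ) → ∑ (allPts n) (φ ∘ proj₁) ≡ ∑ (allVecs n) (λ v → if normalised v then φ v else 0)
  ∑-allPts {n} φ = go (allVecs n)
    where
    go : ∀ vs → ∑ (mapMaybe toPt vs) (φ ∘ proj₁) ≡ ∑ vs (λ v → if normalised v then φ v else 0)
    go [] = refl
    go (v ∷ vs) with T? (normalised v)
    ... | yes t = cong₂ ℕ._+_ (sym (if-T t)) (go vs)
    ... | no nt = trans (go vs) (cong (ℕ._+ _) (sym (if-¬T nt)))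

  ∑-allVecs-suc : ∀ {n} (φ : Vector (suc n) → ℕ) → ∑ (allVecs (suc n)) φ ≡ ∑ elements (λ x → ∑ (allVecs n) (λ v → φ (x ∷ v)))
  ∑-allVecs-suc {n} φ = trans (∑-concatMap elements _ φ) (∑-cong elements (λ x → ∑-map (allVecs n) (x ∷_) φ))

  ∑-allVecs-reindex : ∀ {n} (g : Vector n → Vector n) → (∀ {u v} → g u ≡ g v → u ≡ v) → (φ : Vector n → ℕ) →
    ∑ (allVecs n) (φ ∘ g) ≡ ∑ (allVecs n) φ
  ∑-allVecs-reindex {n} = ∑-reindex (allVecs n) (allVecs-unique n) allVecs-complete _≟ᵥ_

  length-allVecs : ∀ n → length (allVecs n) ≡ q ℕ.^ n
  length-allVecs zero = refl
  length-allVecs (suc n) = begin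
    length (allVecs (suc n)) ≡⟨ ℕₚ.*-identityʳ _ ⟨
    length (allVecs (suc n)) ℕ.* 1 ≡⟨ ∑-const (allVecs (suc n)) 1 ⟨
    ∑ (allVecs (suc n)) (λ _ → 1) ≡⟨ ∑-allVecs-suc {n} (λ _ → 1) ⟩
    ∑ elements (λ _ → ∑ (allVecs n) (λ _ → 1)) ≡⟨ ∑-const elements _ ⟩
    q ℕ.* ∑ (allVecs n) (λ _ → 1) ≡⟨ cong (q ℕ.*_) (trans (∑-const (allVecs n) 1) (ℕₚ.*-identityʳ _)) ⟩
    q ℕ.* length (allVecs n) ≡⟨ cong (q ℕ.*_) (length-allVecs n) ⟩
    q ℕ.* q ℕ.^ n ∎
    where open ≡-Reasoning

  -- Linear maps, independence and span

  record LinearMap (m n : ℕ) : Set where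
    field
      ⟨_⟩   : Vector m → Vector n
      ⟨⟩-⊕ : ∀ u v → ⟨_⟩ (u ⊕ v) ≡ ⟨_⟩ u ⊕ ⟨_⟩ v
      ⟨⟩-⊙ : ∀ c v → ⟨_⟩ (c ⊙ v) ≡ c ⊙ ⟨_⟩ v

    ⟨⟩-zero : ⟨_⟩ zeroV ≡ zeroV
    ⟨⟩-zero = trans (cong ⟨_⟩ (sym (0⊙ zeroV))) (trans (⟨⟩-⊙ 0# zeroV) (0⊙ _))

    Injective : Set
    Injective = ∀ v → ⟨_⟩ v ≡ zeroV → v ≡ zeroV

    ⟨⟩-cancel : Injective → ∀ {u v} → ⟨_⟩ u ≡ ⟨_⟩ v → u ≡ v
    ⟨⟩-cancel inj {u} {v} eq = ⊕-difference u v (inj _ (begin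
      ⟨_⟩ (u ⊕ (- 1#) ⊙ v) ≡⟨ ⟨⟩-⊕ u _ ⟩
      ⟨_⟩ u ⊕ ⟨_⟩ ((- 1#) ⊙ v) ≡⟨ cong₂ _⊕_ eq (⟨⟩-⊙ (- 1#) v) ⟩
      ⟨_⟩ v ⊕ (- 1#) ⊙ ⟨_⟩ v ≡⟨ ⊕-inverseʳ _ ⟩
      zeroV ∎))
      where open ≡-Reasoning

  open LinearMap public

  -- The space is finite, so existence is settled by search. This makes spans decidable and
  -- justifies the arguments by contradiction below.
  ∃Vec? : ∀ {n} {P : Vector n → Set} → (∀ v → Dec (P v)) → Dec (∃ P)
  ∃Vec? {n} P? = map′ Any.satisfied (λ { (v , pv) → lose (allVecs-complete v) pv }) (Any.any? P? (allVecs n))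

  -- Pigeonhole takes the place of elimination: with trivial kernel, L would embed q^m vectors among
  -- q^n < q^m.
  kernel : ∀ {m n} (L : LinearMap m n) → n < m → ∃ λ v → v ≢ zeroV × ⟨ L ⟩ v ≡ zeroV
  kernel {m} {n} L n<m with ∃Vec? (λ v → ¬? (v ≟ᵥ zeroV) ×-dec (⟨ L ⟩ v ≟ᵥ zeroV))
  ... | yes found = found
  ... | no none = ⊥-elim (ℕₚ.<⇒≱ (ℕₚ.^-monoʳ-< q 1<q n<m) (subst₂ _≤_
          (trans (length-map ⟨ L ⟩ (allVecs m)) (length-allVecs m)) (length-allVecs n)
          (unique-⊆⇒length≤ (Uniqueₚ.map⁺ (⟨⟩-cancel L inj) (allVecs-unique m)) (λ {v} _ → allVecs-complete v))))
    where
    inj : Injective L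
    inj v eq with v ≟ᵥ zeroV
    ... | yes v≡0 = v≡0
    ... | no v≢0 = ⊥-elim (none (v , v≢0 , eq))

  extend : ∀ {m n} → Vector n → LinearMap m n → LinearMap (suc m) n
  extend w L = record
    { ⟨_⟩ = λ { (c ∷ v) → c ⊙ w ⊕ ⟨ L ⟩ v }
    ; ⟨⟩-⊕ = λ { (c ∷ u) (d ∷ v) → trans (cong₂ _⊕_ (⊙-distribʳ c d w) (⟨⟩-⊕ L u v)) (interchange _ _ _ _) }
    ; ⟨⟩-⊙ = λ { a (c ∷ v) → trans (cong₂ _⊕_ (sym (⊙-⊙ a c w)) (⟨⟩-⊙ L a v)) (sym (⊙-distribˡ a _ _)) }
    }
    where
    interchange : ∀ {n} (a b c d : Vector n) → (a ⊕ b) ⊕ (c ⊕ d) ≡ (a ⊕ c) ⊕ (b ⊕ d)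
    interchange [] [] [] [] = refl
    interchange (a ∷ as) (b ∷ bs) (c ∷ cs) (d ∷ ds) = cong₂ _∷_
      (solve 4 (λ a b c d → (a :+ b) :+ (c :+ d) := (a :+ c) :+ (b :+ d)) refl a b c d) (interchange as bs cs ds)

  extend-injective : ∀ {m n} (w : Vector n) (L : LinearMap m n) → Injective L → (∀ v → ⟨ L ⟩ v ≢ w) → Injective (extend w L)
  extend-injective w L inj w∉ (c ∷ v) eq with c ≟ 0#
  ... | yes refl = cong (0# ∷_) (inj v (trans (sym (⊕-identityˡ _)) (trans (cong (_⊕ ⟨ L ⟩ v) (sym (0⊙ w))) eq)))
  ... | no nc = ⊥-elim (w∉ _ (trans (⟨⟩-⊙ L _ v) (sym (solve-for nc w (⟨ L ⟩ v) eq))))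

  -- A missed w could be adjoined as a further basis image, giving an injective map from dimension m
  -- + 1 > n, against `kernel`.
  surjective : ∀ {m n} (L : LinearMap m n) → Injective L → n ≤ m → ∀ w → ∃ λ v → ⟨ L ⟩ v ≡ w
  surjective L inj n≤m w = decidable-stable (∃Vec? (λ v → ⟨ L ⟩ v ≟ᵥ w)) λ none →
    let v , v≢0 , eq = kernel (extend w L) (s≤s n≤m) in
    v≢0 (extend-injective w L inj (λ v eq → none (v , eq)) v eq)

  -- The `lincomb` of the statement with its coefficients in a vector of matching length, so that
  -- dimension arguments for linear maps apply to it.
  comb : ∀ {n} (vs : List (Vector n)) → LinearMap (length vs) n
  comb [] = record { ⟨_⟩ = λ _ → zeroV ; ⟨⟩-⊕ = λ _ _ → sym (⊕-identityˡ zeroV) ; ⟨⟩-⊙ = λ c _ → sym (⊙-zeroV c) }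
  comb (v ∷ vs) = extend v (comb vs)

  -- Independent lists, spans and annihilators

  LI : ∀ {n} → List (Vector n) → Set
  LI vs = Injective (comb vs)

  Span : ∀ {n} → List (Vector n) → Vector n → Set
  Span vs v = ∃ λ c → ⟨ comb vs ⟩ c ≡ v

  Span? : ∀ {n} (vs : List (Vector n)) v → Dec (Span vs v)
  Span? vs v = ∃Vec? (λ c → ⟨ comb vs ⟩ c ≟ᵥ v)

  LI-∷ : ∀ {n} {vs : List (Vector n)} {v} → LI vs → ¬ Span vs v → LI (v ∷ vs)
  LI-∷ {vs = vs} li v∉ = extend-injective _ (comb vs) li (λ c eq → v∉ (c , eq))

  Span-⊕ : ∀ {n} {vs : List (Vector n)} {u v} → Span vs u → Span vs v → Span vs (u ⊕ v)
  Span-⊕ {vs = vs} (c , refl) (d , refl) = c ⊕ d , ⟨⟩-⊕ (comb vs) c d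

  Span-⊙ : ∀ {n} {vs : List (Vector n)} {v} a → Span vs v → Span vs (a ⊙ v)
  Span-⊙ {vs = vs} a (c , refl) = a ⊙ c , ⟨⟩-⊙ (comb vs) a c

  Span-head : ∀ {n} {vs : List (Vector n)} {v} → Span (v ∷ vs) v
  Span-head {vs = vs} {v} = 1# ∷ zeroV , trans (cong₂ _⊕_ (1⊙ v) (⟨⟩-zero (comb vs))) (⊕-identityʳ v)

  Span-tail : ∀ {n} {vs : List (Vector n)} {u v} → Span vs v → Span (u ∷ vs) v
  Span-tail {u = u} (c , refl) = 0# ∷ c , trans (cong (_⊕ _) (0⊙ u)) (⊕-identityˡ _)

  LI⇒length≤ : ∀ {n} {vs : List (Vector n)} → LI vs → length vs ≤ n
  LI⇒length≤ {n} {vs} li = ℕₚ.≮⇒≥ λ n<l → let c , c≢0 , eq = kernel (comb vs) n<l in c≢0 (li c eq)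

  LI⇒spanning : ∀ {n} {vs : List (Vector n)} → LI vs → n ≤ length vs → ∀ v → Span vs v
  LI⇒spanning {vs = vs} li = surjective (comb vs) li

  dot-Span : ∀ {n} {f : Vector n} {vs v} → All (λ u → dot f u ≡ 0#) vs → Span vs v → dot f v ≡ 0#
  dot-Span {f = f} [] ([] , refl) = dot-zeroʳ f
  dot-Span {f = f} {v ∷ vs} (z ∷ zs) (c ∷ cs , refl) = trans (dot-⊕ʳ f _ _)
    (trans (cong₂ _+_ (trans (dot-⊙ʳ f c v) (trans (cong (c *_) z) (zeroʳ c))) (dot-Span {f = f} zs (cs , refl))) (+-identityʳ 0#))

  evaluations : ∀ {n} (vs : List (Vector n)) → LinearMap n (length vs)
  evaluations [] = record { ⟨_⟩ = λ _ → [] ; ⟨⟩-⊕ = λ _ _ → refl ; ⟨⟩-⊙ = λ _ _ → refl }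
  evaluations (v ∷ vs) = record
    { ⟨_⟩ = λ f → dot f v ∷ ⟨ evaluations vs ⟩ f
    ; ⟨⟩-⊕ = λ f g → cong₂ _∷_ (dot-⊕ˡ f g v) (⟨⟩-⊕ (evaluations vs) f g)
    ; ⟨⟩-⊙ = λ c f → cong₂ _∷_ (dot-⊙ˡ c f v) (⟨⟩-⊙ (evaluations vs) c f)
    }

  -- Evaluating functionals at the given vectors is a linear map into a smaller dimension, so it has
  -- a kernel.
  annihilator : ∀ {n} (vs : List (Vector n)) → length vs < n → ∃ λ f → f ≢ zeroV × All (λ v → dot f v ≡ 0#) vs
  annihilator {n} vs l<n = let f , f≢0 , eq = kernel (evaluations vs) l<n in f , f≢0 , go f vs eq
    where
    go : ∀ f (vs : List (Vector n)) → ⟨ evaluations vs ⟩ f ≡ zeroV → All (λ v → dot f v ≡ 0#) vs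
    go f [] _ = []
    go f (v ∷ vs) eq = Vecₚ.∷-injectiveˡ eq ∷ go f vs (Vecₚ.∷-injectiveʳ eq)

  coords : ∀ {n} → List (Pt n) → List (Vector n)
  coords = map proj₁

  lincomb-toList : ∀ {n} (vs : List (Vector n)) (c : Vector (length vs)) → lincomb (V.toList c) vs ≡ ⟨ comb vs ⟩ c
  lincomb-toList [] [] = refl
  lincomb-toList (v ∷ vs) (x ∷ c) = cong (x ⊙ v ⊕_) (lincomb-toList vs c)

  All-zero⇒zeroV : ∀ {n} (c : Vector n) → All (_≡ 0#) (V.toList c) → c ≡ zeroV
  All-zero⇒zeroV [] [] = refl
  All-zero⇒zeroV (x ∷ c) (z ∷ zs) = cong₂ _∷_ z (All-zero⇒zeroV c zs)

  zeroV⇒All-zero : ∀ n → All (_≡ 0#) (V.toList (zeroV {n}))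
  zeroV⇒All-zero zero = []
  zeroV⇒All-zero (suc n) = refl ∷ zeroV⇒All-zero n

  Indep⇒LI : ∀ {n} (ps : List (Pt n)) → Indep ps → LI (coords ps)
  Indep⇒LI ps ind c eq = All-zero⇒zeroV c (ind (V.toList c) (trans (Vecₚ.length-toList c) (length-map proj₁ ps))
    (trans (lincomb-toList (coords ps) c) eq))

  LI⇒Indep : ∀ {n} (ps : List (Pt n)) → LI (coords ps) → Indep ps
  LI⇒Indep ps li cs len eq = go (trans (length-map proj₁ ps) (sym len))
    where
    vector : ∀ {m} → m ≡ length cs → ∃ λ (c : Vector m) → V.toList c ≡ cs
    vector refl = V.fromList cs , Vecₚ.toList∘fromList cs
    go : length (coords ps) ≡ length cs → All (_≡ 0#) cs
    go len′ with vector len′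
    ... | c , refl with li c (trans (sym (lincomb-toList (coords ps) c)) eq)
    ... | refl = zeroV⇒All-zero (length (coords ps))

  basisOf : ∀ {n} (xs : List (Pt n)) → ∃ λ ps →
    All (_∈ xs) ps × LI (coords ps) × All (λ x → Span (coords ps) (proj₁ x)) xs
  basisOf [] = [] , [] , (λ { [] _ → refl }) , []
  basisOf (x ∷ xs) with basisOf xs
  ... | ps , sub , li , sp with Span? (coords ps) (proj₁ x)
  ... | yes x∈ = ps , All.map there sub , li , x∈ ∷ sp
  ... | no x∉ = x ∷ ps , here refl ∷ All.map there sub , LI-∷ {vs = coords ps} li x∉
              , Span-head {vs = coords ps} ∷ All.map (Span-tail {vs = coords ps}) sp

  basisOfSet : ∀ {n} (S : PtSet n) → ∃ λ ps → All (_∈S S) ps × LI (coords ps) × (∀ p → p ∈S S → Span (coords ps) (proj₁ p))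
  basisOfSet {n} S with basisOf (filter (T? ∘ S) (allPts n))
  ... | ps , sub , li , sp = ps , All.map (proj₂ ∘ ∈-filter⁻ (T? ∘ S) {xs = allPts n}) sub , li
      , λ p p∈ → All.lookup sp (∈-filter⁺ (T? ∘ S) (allPts-complete p) p∈)

  -- The link between cocircuits and functionals: a maximal independent subset of S has r members,
  -- or too few, and then a functional annihilates it and hence S.
  basis-or-hyperplane : ∀ {r} (S : PtSet r) → ContainsBasis r S ⊎ (∃ λ f → f ≢ zeroV × (∀ p → p ∈S S → dot f (proj₁ p) ≡ 0#))
  basis-or-hyperplane {r} S with basisOfSet S
  ... | ps , sub , li , sp with length ps ℕ.≟ r
  ... | yes eq = inj₁ (ps , sub , eq , LI⇒Indep ps li)
  ... | no neq = let f , f≢0 , z = annihilator (coords ps) (ℕₚ.≤∧≢⇒< (LI⇒length≤ {vs = coords ps} li) (neq ∘ trans (sym (length-map proj₁ ps)))) in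
        inj₂ (f , f≢0 , λ p p∈ → dot-Span {f = f} z (sp p p∈))

  basis-spans : ∀ {r} {S : PtSet r} (b : ContainsBasis r S) v → Span (coords (proj₁ b)) v
  basis-spans (ps , _ , len , ind) = LI⇒spanning {vs = coords ps} (Indep⇒LI ps ind)
    (ℕₚ.≤-reflexive (sym (trans (length-map proj₁ ps) len)))

  -- A basis inside the kernel would span every vector, including one where f takes the value 1.
  hyperplane-has-no-basis : ∀ {r} {S : PtSet r} (f : Vector r) → f ≢ zeroV → (∀ p → p ∈S S → dot f (proj₁ p) ≡ 0#) → ¬ ContainsBasis r S
  hyperplane-has-no-basis f f≢0 z b@(ps , sub , _) with dual f f≢0
  ... | g , eq = 0≢1 (trans (sym (dot-Span {f = f} (Allₚ.map⁺ (All.map (λ {p} → z p) sub)) (basis-spans b g))) (trans (dot-comm f g) eq))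

  full-contains-basis : ∀ k → ContainsBasis k full
  full-contains-basis k with basis-or-hyperplane (full {k})
  ... | inj₁ b = b
  ... | inj₂ (f , f≢0 , z) with dual f f≢0
  ... | g , eq with pointOf g (λ { refl → 0≢1 (trans (sym (dot-zeroʳ f)) (trans (dot-comm f zeroV) eq)) })
  ... | p , c , _ , refl = ⊥-elim (0≢1 (trans (sym (trans (dot-⊙ʳ f c _) (trans (cong (c *_) (z p tt)) (zeroʳ c)))) (trans (dot-comm f _) eq)))

  -- Subspaces described by their lines. The coefficients may be zero and the two points may
  -- coincide.
  Closed : ∀ {n} → PtSet n → Set
  Closed Q = ∀ p p′ x a b → p ∈S Q → p′ ∈S Q → proj₁ x ≡ a ⊙ proj₁ p ⊕ b ⊙ proj₁ p′ → x ∈S Q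

  -- Along a linear combination each partial sum is either zero or represents a point of Q; one more
  -- summand stays on a line through two points of Q.
  closed-Span : ∀ {n} {Q : PtSet n} → Closed Q → ∀ ps → All (_∈S Q) ps → ∀ x → Span (coords ps) (proj₁ x) → x ∈S Q
  closed-Span {n} {Q} cl ps sub x (c , eq) with go ps sub c
    where
    go : ∀ ps → All (_∈S Q) ps → ∀ c → ⟨ comb (coords ps) ⟩ c ≡ zeroV ⊎ (∃ λ p → p ∈S Q × ⟨ comb (coords ps) ⟩ c ∼ p)
    go [] [] c = inj₁ refl
    go (p ∷ ps) (p∈ ∷ sub) (a ∷ c) with (a ⊙ proj₁ p ⊕ ⟨ comb (coords ps) ⟩ c) ≟ᵥ zeroV
    ... | yes z = inj₁ z
    ... | no nz with pointOf _ nz | go ps sub c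
    -- The rest of the sum vanishes, so the line degenerates: p is used twice, the second time with
    -- coefficient 0.
    ... | y , y∼ | inj₁ z = let d , _ , eq = ∼-sym {p = y} y∼ in inj₂ (y , cl p p y (d * a) 0# p∈ p∈
            (trans eq (trans (⊙-distribˡ d _ _) (cong₂ _⊕_ (⊙-⊙ d a _) (trans (cong (d ⊙_) z) (trans (⊙-zeroV d) (sym (0⊙ _))))))) , y∼)
    ... | y , y∼ | inj₂ (p′ , p′∈ , b , _ , eq′) = let d , _ , eq = ∼-sym {p = y} y∼ in inj₂ (y , cl p p′ y (d * a) (d * b) p∈ p′∈
            (trans eq (trans (⊙-distribˡ d _ _) (cong₂ _⊕_ (⊙-⊙ d a _) (trans (cong (d ⊙_) eq′) (⊙-⊙ d b _))))) , y∼)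
  ... | inj₁ z = ⊥-elim (point≢0 x (trans (sym eq) z))
  ... | inj₂ (p , p∈ , p∼) = subst (_∈S Q) (∼-unique p∼ (subst (_∼ x) (sym eq) (∼-refl x))) p∈

  -- Normalised representatives are mapped to each other only up to nonzero scalars. Multiplying or
  -- dividing the coefficients by these scalars carries relations across in both directions and
  -- never turns a nontrivial relation into the trivial one.
  LI-transfer : ∀ {X : Set} {k n} (L : LinearMap k n) → Injective L → (u : X → Vector k) (v : X → Vector n) →
    (∀ x → ∃ λ c → c ≢ 0# × ⟨ L ⟩ (u x) ≡ c ⊙ v x) → ∀ xs → LI (map u xs) ⇔ LI (map v xs)
  LI-transfer {X} {k} {n} L inj u v rel xs = mk⇔ forth back
    where
    pull : ∀ xs c → ∃ λ c′ → ⟨ L ⟩ (⟨ comb (map u xs) ⟩ c′) ≡ ⟨ comb (map v xs) ⟩ c × (c′ ≡ zeroV → c ≡ zeroV)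
    pull [] [] = [] , ⟨⟩-zero L , id
    pull (x ∷ xs) (a ∷ c) with pull xs c | rel x
    ... | c′ , eq , z | d , nd , Lu = (a * (d ⁻¹)) ∷ c′
        , trans (⟨⟩-⊕ L _ _) (cong₂ _⊕_ (trans (⟨⟩-⊙ L _ (u x)) (trans (cong ((a * (d ⁻¹)) ⊙_) Lu) (trans (⊙-⊙ _ d _) (cong (_⊙ v x)
            (trans (*-assoc a _ d) (trans (cong (a *_) (⁻¹-inverseˡ nd)) (*-identityʳ a))))))) eq)
        , λ e → cong₂ _∷_ (*-cancelˡ-zero (⁻¹-≢0 nd) (trans (*-comm _ a) (Vecₚ.∷-injectiveˡ e))) (z (Vecₚ.∷-injectiveʳ e))
    push : ∀ xs c → ∃ λ c′ → ⟨ comb (map v xs) ⟩ c′ ≡ ⟨ L ⟩ (⟨ comb (map u xs) ⟩ c) × (c′ ≡ zeroV → c ≡ zeroV)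
    push [] [] = [] , sym (⟨⟩-zero L) , id
    push (x ∷ xs) (a ∷ c) with push xs c | rel x
    ... | c′ , eq , z | d , nd , Lu = (a * d) ∷ c′
        , sym (trans (⟨⟩-⊕ L _ _) (cong₂ _⊕_ (trans (⟨⟩-⊙ L a (u x)) (trans (cong (a ⊙_) Lu) (⊙-⊙ a d _))) (sym eq)))
        , λ e → cong₂ _∷_ (*-cancelˡ-zero nd (trans (*-comm d a) (Vecₚ.∷-injectiveˡ e))) (z (Vecₚ.∷-injectiveʳ e))
    forth : LI (map u xs) → LI (map v xs)
    forth li c eq with pull xs c
    ... | c′ , eq′ , z = z (li c′ (inj _ (trans eq′ eq)))
    back : LI (map v xs) → LI (map u xs)
    back li c eq with push xs c
    ... | c′ , eq′ , z = z (li c′ (trans eq′ (trans (cong ⟨ L ⟩ eq) (⟨⟩-zero L))))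

  -- Matroid isomorphisms

  Elem-≡ : ∀ {n} {S : PtSet n} {x y : Elem S} → proj₁ x ≡ proj₁ y → x ≡ y
  Elem-≡ {x = _ , t} {_ , t′} refl = cong (_ ,_) (Boolₚ.T-irrelevant t t′)

  module _ {k n} (L : LinearMap k n) (inj : Injective L) {S : PtSet n} {S′ : PtSet k}
    (image : ∀ c p → ⟨ L ⟩ (proj₁ c) ∼ p → c ∈S S′ → p ∈S S)
    (preimage : ∀ p → p ∈S S → ∃ λ c → c ∈S S′ × ⟨ L ⟩ (proj₁ c) ∼ p) where

    private
      to : Elem S → Elem S′
      to (p , p∈) = let c , c∈ , _ = preimage p p∈ in c , c∈

      to-∼ : ∀ x → ⟨ L ⟩ (proj₁ (proj₁ (to x))) ∼ proj₁ x
      to-∼ (p , p∈) = proj₂ (proj₂ (preimage p p∈))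

      image-point : (c : Pt k) → ∃ λ p → ⟨ L ⟩ (proj₁ c) ∼ p
      image-point c = pointOf (⟨ L ⟩ (proj₁ c)) (point≢0 c ∘ inj _)

      from : Elem S′ → Elem S
      from (c , c∈) = let p , p∼ = image-point c in p , image c p p∼ c∈

      L-∼-injective : ∀ {c c′ : Pt k} {p} → ⟨ L ⟩ (proj₁ c) ∼ p → ⟨ L ⟩ (proj₁ c′) ∼ p → c ≡ c′
      L-∼-injective {c} {c′} (a , na , ea) (b , nb , eb) = ∼-unique {v = (b * (a ⁻¹)) ⊙ proj₁ c}
        (_ , *-≢0 nb (⁻¹-≢0 na) , refl)
        (subst (_∼ c′) (⟨⟩-cancel L inj (trans eb (sym (trans (⟨⟩-⊙ L _ _) (trans (cong ((b * (a ⁻¹)) ⊙_) ea)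
           (trans (⊙-⊙ _ a _) (cong (_⊙ _) (trans (*-assoc b _ a) (trans (cong (b *_) (⁻¹-inverseˡ na)) (*-identityʳ b)))))))))) (∼-refl c′))

    -- The isomorphism runs against L: `to` picks the preimage of a point, `from` applies L and
    -- normalises.
    linear-iso : Iso S S′
    linear-iso = record
      { to = to
      ; from = from
      ; from∘to = λ x → Elem-≡ (∼-unique {p = proj₁ (from (to x))} {proj₁ x} (proj₂ (image-point (proj₁ (to x)))) (to-∼ x))
      ; to∘from = λ { y@(c , c∈) → Elem-≡ (L-∼-injective {proj₁ (to (from y))} {c} {proj₁ (from y)} (to-∼ (from y)) (proj₂ (image-point c))) }
      ; preservesIndep = λ xs →
          let e = LI-transfer L inj (proj₁ ∘ proj₁ ∘ to) (proj₁ ∘ proj₁) to-∼ xs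
              l = map-∘ {g = proj₁} {f = proj₁} xs
              r = map-∘ {g = proj₁} {f = proj₁ ∘ to} xs
          in mk⇔ (λ i → LI⇒Indep _ (subst LI r (Equivalence.from e (subst LI (sym l) (Indep⇒LI _ i)))))
                 (λ i → LI⇒Indep _ (subst LI l (Equivalence.to e (subst LI (sym r) (Indep⇒LI _ i)))))
      }

  Iso-sym : ∀ {a b} {S : PtSet a} {S′ : PtSet b} → Iso S S′ → Iso S′ S
  Iso-sym I = record
    { to = from ; from = to ; from∘to = to∘from ; to∘from = from∘to
    ; preservesIndep = λ ys →
        let e = preservesIndep (map from ys)
            l = sym (map-∘ {g = proj₁} {f = from} ys)
            r = trans (sym (map-∘ {g = proj₁ ∘ to} {f = from} ys)) (map-cong (λ y → cong proj₁ (to∘from y)) ys)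
        in mk⇔ (λ i → subst Indep l (Equivalence.from e (subst Indep (sym r) i)))
               (λ i → subst Indep r (Equivalence.to e (subst Indep (sym l) i)))
    }
    where open Iso I

  full-iso : ∀ {n} {S : PtSet n} → (∀ p → p ∈S S) → Iso S (full {n})
  full-iso all = record
    { to = λ x → proj₁ x , tt ; from = λ y → proj₁ y , all _ ; from∘to = λ _ → Elem-≡ refl ; to∘from = λ _ → refl
    ; preservesIndep = λ _ → mk⇔ id id }

  -- Reading off coefficients with respect to `vs` turns ι into an injective self-map χ of the
  -- finite point set of P_k, which is therefore onto.
  injection-onto-span : ∀ {k n} (ι : Pt k → Pt n) → (∀ {c c′} → ι c ≡ ι c′ → c ≡ c′) → ∀ {vs} → length vs ≡ k →
    (∀ c → Span vs (proj₁ (ι c))) → ∀ p → Span vs (proj₁ p) → ∃ λ c → ι c ≡ p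
  injection-onto-span {n = n} ι inj {vs} refl sp p (a , eq) = c , ∼-unique {p = ι c} {p} p∼ιc (∼-refl p)
    where
    coefficient≢0 : ∀ {a} {p : Pt n} → ⟨ comb vs ⟩ a ≡ proj₁ p → a ≢ zeroV
    coefficient≢0 {p = p} e refl = point≢0 p (trans (sym e) (⟨⟩-zero (comb vs)))
    χ : ∀ c → ∃ λ d → proj₁ (sp c) ∼ d
    χ c = pointOf (proj₁ (sp c)) (coefficient≢0 {p = ι c} (proj₂ (sp c)))
    same-point : ∀ {a b d} {p p′ : Pt n} → ⟨ comb vs ⟩ a ≡ proj₁ p → ⟨ comb vs ⟩ b ≡ proj₁ p′ → a ∼ d → b ∼ d → proj₁ p′ ∼ p
    same-point {d = d} {p} {p′} ea eb (s , ns , refl) (t , nt , refl) = t * (s ⁻¹) , *-≢0 nt (⁻¹-≢0 ns) , (begin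
      proj₁ p′ ≡⟨ eb ⟨
      ⟨ comb vs ⟩ (t ⊙ proj₁ d) ≡⟨ ⟨⟩-⊙ (comb vs) t _ ⟩
      t ⊙ ⟨ comb vs ⟩ (proj₁ d) ≡⟨ cong (t ⊙_) (⊙-inverse ns _) ⟨
      t ⊙ ((s ⁻¹) ⊙ (s ⊙ ⟨ comb vs ⟩ (proj₁ d))) ≡⟨ ⊙-⊙ t _ _ ⟩
      (t * (s ⁻¹)) ⊙ (s ⊙ ⟨ comb vs ⟩ (proj₁ d)) ≡⟨ cong ((t * (s ⁻¹)) ⊙_) (trans (sym (⟨⟩-⊙ (comb vs) s _)) ea) ⟩
      (t * (s ⁻¹)) ⊙ proj₁ p ∎)
      where open ≡-Reasoning
    χ-injective : ∀ {c c′} → proj₁ (χ c) ≡ proj₁ (χ c′) → c ≡ c′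
    χ-injective {c} {c′} e = inj (∼-unique (same-point {d = proj₁ (χ c′)} {ι c} {ι c′} (proj₂ (sp c)) (proj₂ (sp c′)) (subst (proj₁ (sp c) ∼_) e (proj₂ (χ c))) (proj₂ (χ c′))) (∼-refl (ι c′)))
    target : ∃ λ d → a ∼ d
    target = pointOf a (coefficient≢0 {p = p} eq)
    onto : ∃ λ c → proj₁ (χ c) ≡ proj₁ target
    onto = injective⇒surjective _≟ₚ_ (allPts _) (allPts-unique _) allPts-complete (proj₁ ∘ χ) χ-injective (proj₁ target)
    c = proj₁ onto
    p∼ιc : proj₁ p ∼ ι c
    p∼ιc = same-point {d = proj₁ target} {ι c} {p} (proj₂ (sp c)) eq (subst (proj₁ (sp c) ∼_) (proj₂ onto) (proj₂ (χ c))) (proj₂ target)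

  elements-of : ∀ {n} {S : PtSet n} {ps} → All (_∈S S) ps → ∃ λ (xs : List (Elem S)) → map proj₁ xs ≡ ps
  elements-of [] = [] , refl
  elements-of (p∈ ∷ ps∈) = let xs , eq = elements-of ps∈ in (_ , p∈) ∷ xs , cong (_ ∷_) eq

  full-iso⇒length≤ : ∀ {n k} {S : PtSet n} → Iso S (full {k}) → ∀ {ps} → All (_∈S S) ps → LI (coords ps) → length ps ≤ k
  full-iso⇒length≤ {k = k} I ps∈ li with elements-of ps∈
  ... | xs , refl = subst (_≤ k) (trans (length-map proj₁ (map (proj₁ ∘ to) xs)) (trans (length-map (proj₁ ∘ to) xs) (sym (length-map proj₁ xs))))
        (LI⇒length≤ {vs = coords (map (proj₁ ∘ to) xs)} (Indep⇒LI _ (Equivalence.to (preservesIndep xs) (LI⇒Indep _ li))))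
    where open Iso I

  -- The isomorphism transports independence but not spans. A point of S outside the span of the
  -- image of a basis would give k + 1 independent points in rank k; conversely the points of P_k
  -- inject into that span and must fill it.
  full-iso⇒span : ∀ {n k} {S : PtSet n} → Iso S (full {k}) →
    ∃ λ ps → length ps ≡ k × LI (coords ps) × (∀ p → p ∈S S → Span (coords ps) (proj₁ p)) × (∀ p → Span (coords ps) (proj₁ p) → p ∈S S)
  full-iso⇒span {n} {k} {S} I with full-contains-basis k
  ... | cs , _ , len , ind = ps , len-ps , li , inside , outside
    where
    open Iso I
    es : List (Elem (full {k}))
    es = map (_, tt) cs
    ps = map (proj₁ ∘ from) es
    len-ps : length ps ≡ k
    len-ps = trans (length-map (proj₁ ∘ from) es) (trans (length-map (_, tt) cs) len)
    li : LI (coords ps)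
    li = Indep⇒LI ps (Equivalence.to (Iso.preservesIndep (Iso-sym I) es) (subst Indep (trans (sym (map-id cs)) (map-∘ {g = proj₁} {f = _, tt} cs)) ind))
    inside : ∀ p → p ∈S S → Span (coords ps) (proj₁ p)
    inside p p∈ = decidable-stable (Span? (coords ps) (proj₁ p)) λ p∉ →
      ℕₚ.<-irrefl refl (subst (λ m → suc m ≤ k) len-ps
        (full-iso⇒length≤ I {p ∷ ps} (p∈ ∷ Allₚ.map⁺ (All.tabulate (λ {e} _ → proj₂ (from e)))) (LI-∷ {vs = coords ps} li p∉)))
    outside : ∀ p → Span (coords ps) (proj₁ p) → p ∈S S
    outside p sp with injection-onto-span (λ c → proj₁ (from (c , tt))) from-injective {coords ps}
                       (trans (length-map proj₁ ps) len-ps) (λ c → inside _ (proj₂ (from (c , tt)))) p sp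
      where
      from-injective : ∀ {c c′} → proj₁ (from (c , tt)) ≡ proj₁ (from (c′ , tt)) → c ≡ c′
      from-injective {c} {c′} e = cong proj₁ (trans (sym (to∘from (c , tt))) (trans (cong to (Elem-≡ e)) (to∘from (c′ , tt))))
    ... | c , refl = proj₂ (from (c , tt))

  span⇒full-iso : ∀ {n k} {S : PtSet n} vs → LI vs → length vs ≡ k →
    (∀ p → p ∈S S → Span vs (proj₁ p)) → (∀ p → Span vs (proj₁ p) → p ∈S S) → Iso S (full {k})
  span⇒full-iso {S = S} vs li refl inside outside = linear-iso (comb vs) li
    (λ { c p (a , na , eq) _ → outside p (let d , _ , e = ∼-sym {v = ⟨ comb vs ⟩ (proj₁ c)} {p} (a , na , eq) in d ⊙ proj₁ c , trans (⟨⟩-⊙ (comb vs) d _) (sym e)) })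
    preimage
    where
    preimage : ∀ p → p ∈S S → ∃ λ c → T true × ⟨ comb vs ⟩ (proj₁ c) ∼ p
    preimage p p∈ with inside p p∈
    ... | a , eq with pointOf a (λ { refl → point≢0 p (trans (sym eq) (⟨⟩-zero (comb vs))) })
    ... | c , d , nd , refl = c , tt , d ⁻¹ , ⁻¹-≢0 nd , trans (sym (⊙-inverse nd _)) (cong ((d ⁻¹) ⊙_) (trans (sym (⟨⟩-⊙ (comb vs) d _)) eq))

  -- Counting functionals

  nonZero : Carrier → Bool
  nonZero x = not (isZero x)

  nonZero-yes : ∀ {x} → x ≢ 0# → nonZero x ≡ true
  nonZero-yes {x} nx with x ≟ 0#
  ... | yes eq = ⊥-elim (nx eq)
  ... | no _ = refl

  nonZero-no : ∀ {x} → x ≡ 0# → nonZero x ≡ false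
  nonZero-no {x} eq with x ≟ 0#
  ... | yes _ = refl
  ... | no nx = ⊥-elim (nx eq)

  nonZero⇒≢0 : ∀ {x} → T (nonZero x) → x ≢ 0#
  nonZero⇒≢0 {x} t eq = subst T (nonZero-no eq) t

  ≢0⇒nonZero : ∀ {x} → x ≢ 0# → T (nonZero x)
  ≢0⇒nonZero nx = subst T (sym (nonZero-yes nx)) _

  nonZero-* : ∀ {c} x → c ≢ 0# → nonZero (c * x) ≡ nonZero x
  nonZero-* {c} x nc = cong not (⌊⌋-cong ((c * x) ≟ 0#) (x ≟ 0#) (*-cancelˡ-zero nc) (λ { refl → zeroʳ c }))

  -- Translation by multiples of h permutes the level sets of dot _ y, so these carry equal shares of ψ.
  equidistribution : ∀ {n} (ψ : Vector n → ℕ) (y h : Vector n) → dot h y ≡ 1# → (∀ c f → ψ (f ⊕ c ⊙ h) ≡ ψ f) →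
    q ℕ.* ∑ (allVecs n) (λ f → ψ f ℕ.* ⟦ nonZero (dot f y) ⟧) ≡ (q ∸ 1) ℕ.* ∑ (allVecs n) ψ
  equidistribution {n} ψ y h hy inv = complement-share q _ (Z 0#) (ℕₚ.<⇒≤ 1<q) parts (trans (sym (∑-const elements (Z 0#))) total)
    where
    open ≡-Reasoning
    fs = allVecs n
    Z : Carrier → ℕ
    Z a = ∑ fs (λ f → ψ f ℕ.* ⟦ ⌊ dot f y ≟ a ⌋ ⟧)
    dot-shift : ∀ a f → dot (f ⊕ a ⊙ h) y ≡ (dot f y + a)
    dot-shift a f = trans (dot-⊕ˡ f _ y) (cong (dot f y +_) (trans (dot-⊙ˡ a h y) (trans (cong (a *_) hy) (*-identityʳ a))))
    Z-const : ∀ a → Z 0# ≡ Z a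
    Z-const a = trans
      (∑-cong fs λ f → cong₂ ℕ._*_ (sym (inv a f)) (cong ⟦_⟧ (⌊⌋-cong (dot f y ≟ 0#) (dot (f ⊕ a ⊙ h) y ≟ a)
        (λ e → trans (dot-shift a f) (trans (cong (_+ a) e) (+-identityˡ a)))
        (λ e → +-injectiveˡ a (trans (sym (dot-shift a f)) (trans e (sym (+-identityˡ a))))))))
      (∑-allVecs-reindex (_⊕ a ⊙ h) (⊕-cancelʳ (a ⊙ h)) (λ f → ψ f ℕ.* ⟦ ⌊ dot f y ≟ a ⌋ ⟧))
    total : ∑ elements (λ _ → Z 0#) ≡ ∑ fs ψ
    total = begin
      ∑ elements (λ _ → Z 0#) ≡⟨ ∑-cong elements Z-const ⟩
      ∑ elements Z ≡⟨ ∑-swap elements fs _ ⟩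
      ∑ fs (λ f → ∑ elements (λ a → ψ f ℕ.* ⟦ ⌊ dot f y ≟ a ⌋ ⟧)) ≡⟨ ∑-cong fs (λ f → trans (∑-*ˡ elements (ψ f) _)
          (cong (ψ f ℕ.*_) (trans (∑-supported elements _ (dot f y) unique (complete _) (λ a ne → ⟦⌊⌋⟧-no (dot f y ≟ a) (ne ∘ sym)))
             (⟦⌊⌋⟧-yes (dot f y ≟ dot f y) refl)))) ⟩
      ∑ fs (λ f → ψ f ℕ.* 1) ≡⟨ ∑-cong fs (λ f → ℕₚ.*-identityʳ (ψ f)) ⟩
      ∑ fs ψ ∎
    parts : ∑ fs (λ f → ψ f ℕ.* ⟦ nonZero (dot f y) ⟧) ℕ.+ Z 0# ≡ ∑ fs ψ
    parts = trans (sym (∑-+ fs _ _)) (∑-cong fs λ f → trans (sym (ℕₚ.*-distribˡ-+ (ψ f) _ _))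
      (trans (cong (ψ f ℕ.*_) (⟦⟧-split (isZero (dot f y)))) (ℕₚ.*-identityʳ (ψ f))))

  ∑-nonZero : ∑ elements (λ x → ⟦ nonZero x ⟧) ≡ q ∸ 1
  ∑-nonZero = begin
    ∑ elements (λ x → ⟦ nonZero x ⟧) ≡⟨ ℕₚ.m+n∸n≡m _ 1 ⟨
    ∑ elements (λ x → ⟦ nonZero x ⟧) ℕ.+ 1 ∸ 1 ≡⟨ cong (λ z → ∑ elements (λ x → ⟦ nonZero x ⟧) ℕ.+ z ∸ 1) zeros ⟨
    ∑ elements (λ x → ⟦ nonZero x ⟧) ℕ.+ ∑ elements (λ x → ⟦ isZero x ⟧) ∸ 1 ≡⟨ cong (_∸ 1) (trans (sym (∑-+ elements _ _))
       (trans (∑-cong elements (λ x → ⟦⟧-split (isZero x))) (trans (∑-const elements 1) (ℕₚ.*-identityʳ q)))) ⟩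
    q ∸ 1 ∎
    where
    open ≡-Reasoning
    zeros : ∑ elements (λ x → ⟦ isZero x ⟧) ≡ 1
    zeros = trans (∑-supported elements _ 0# unique (complete 0#) (λ x ne → ⟦⌊⌋⟧-no (x ≟ 0#) ne)) (⟦⌊⌋⟧-yes (0# ≟ 0#) refl)

  -- Each point has q - 1 representatives, and φ agrees on them. The induction slices by the leading
  -- coordinate: the slice 0 is the induction hypothesis, and rescaling identifies each of the other
  -- q - 1 slices with the slice 1, the only one that is normalised.
  ∑-points-vs-vectors : ∀ {n} (φ : Vector n → ℕ) → φ zeroV ≡ 0 → (∀ {c} v → c ≢ 0# → φ (c ⊙ v) ≡ φ v) →
    (q ∸ 1) ℕ.* ∑ (allPts n) (φ ∘ proj₁) ≡ ∑ (allVecs n) φ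
  ∑-points-vs-vectors {n} φ φ0 inv = trans (cong ((q ∸ 1) ℕ.*_) (∑-allPts φ)) (go φ φ0 inv)
    where
    open ≡-Reasoning
    go : ∀ {n} (φ : Vector n → ℕ) → φ zeroV ≡ 0 → (∀ {c} v → c ≢ 0# → φ (c ⊙ v) ≡ φ v) →
      (q ∸ 1) ℕ.* ∑ (allVecs n) (λ v → if normalised v then φ v else 0) ≡ ∑ (allVecs n) φ
    go {zero} φ φ0 _ = trans (ℕₚ.*-zeroʳ (q ∸ 1)) (sym (cong (ℕ._+ 0) φ0))
    go {suc n} φ φ0 inv = begin
      (q ∸ 1) ℕ.* ∑ (allVecs (suc n)) (λ v → if normalised v then φ v else 0) ≡⟨ cong ((q ∸ 1) ℕ.*_) (trans (∑-allVecs-suc _) (∑-cong elements leading)) ⟩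
      (q ∸ 1) ℕ.* ∑ elements (λ x → ⟦ isZero x ⟧ ℕ.* a ℕ.+ ⟦ ⌊ x ≟ 1# ⌋ ⟧ ℕ.* b) ≡⟨ cong ((q ∸ 1) ℕ.*_) (trans (∑-+ elements _ _) (cong₂ ℕ._+_ (single 0# a) (single 1# b))) ⟩
      (q ∸ 1) ℕ.* (a ℕ.+ b) ≡⟨ ℕₚ.*-distribˡ-+ (q ∸ 1) a b ⟩
      (q ∸ 1) ℕ.* a ℕ.+ (q ∸ 1) ℕ.* b ≡⟨ cong (ℕ._+ (q ∸ 1) ℕ.* b) (go (φ ∘ (0# ∷_)) φ0 (λ {c} v nc → trans (cong (λ z → φ (z ∷ c ⊙ v)) (sym (zeroʳ c))) (inv (0# ∷ v) nc))) ⟩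
      a′ ℕ.+ (q ∸ 1) ℕ.* b ≡⟨ cong₂ ℕ._+_ (single 0# a′) (trans (∑-*ʳ elements _ b) (cong (ℕ._* b) ∑-nonZero)) ⟨
      ∑ elements (λ x → ⟦ isZero x ⟧ ℕ.* a′) ℕ.+ ∑ elements (λ x → ⟦ nonZero x ⟧ ℕ.* b) ≡⟨ ∑-+ elements _ _ ⟨
      ∑ elements (λ x → ⟦ isZero x ⟧ ℕ.* a′ ℕ.+ ⟦ nonZero x ⟧ ℕ.* b) ≡⟨ ∑-cong elements slices ⟨
      ∑ elements (λ x → ∑ (allVecs n) (λ v → φ (x ∷ v))) ≡⟨ ∑-allVecs-suc φ ⟨
      ∑ (allVecs (suc n)) φ ∎
      where
      a = ∑ (allVecs n) (λ v → if normalised v then φ (0# ∷ v) else 0)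
      a′ = ∑ (allVecs n) (λ v → φ (0# ∷ v))
      b = ∑ (allVecs n) (λ v → φ (1# ∷ v))
      single : ∀ x₀ c → ∑ elements (λ x → ⟦ ⌊ x ≟ x₀ ⌋ ⟧ ℕ.* c) ≡ c
      single x₀ c = trans (∑-*ʳ elements _ c) (trans (cong (ℕ._* c) (trans (∑-supported elements _ x₀ unique (complete x₀) (λ x ne → ⟦⌊⌋⟧-no (x ≟ x₀) ne))
        (⟦⌊⌋⟧-yes (x₀ ≟ x₀) refl))) (ℕₚ.*-identityˡ c))
      leading : ∀ x → ∑ (allVecs n) (λ v → if normalised (x ∷ v) then φ (x ∷ v) else 0) ≡ ⟦ isZero x ⟧ ℕ.* a ℕ.+ ⟦ ⌊ x ≟ 1# ⌋ ⟧ ℕ.* b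
      leading x with x ≟ 0# | x ≟ 1#
      ... | yes refl | yes eq = ⊥-elim (0≢1 eq)
      ... | yes refl | no _ = sym (trans (ℕₚ.+-identityʳ _) (ℕₚ.*-identityˡ a))
      ... | no _ | yes refl = sym (ℕₚ.*-identityˡ b)
      ... | no _ | no _ = ∑-zero (allVecs n)
      slices : ∀ x → ∑ (allVecs n) (λ v → φ (x ∷ v)) ≡ ⟦ isZero x ⟧ ℕ.* a′ ℕ.+ ⟦ nonZero x ⟧ ℕ.* b
      slices x with x ≟ 0#
      ... | yes refl = sym (trans (ℕₚ.+-identityʳ _) (ℕₚ.*-identityˡ a′))
      ... | no nx = trans (sym (∑-allVecs-reindex (x ⊙_) (⊙-cancel nx) (λ v → φ (x ∷ v)))) (trans
              (∑-cong (allVecs n) (λ v → trans (cong (λ z → φ (z ∷ x ⊙ v)) (sym (*-identityʳ x))) (inv (1# ∷ v) nx))) (sym (ℕₚ.*-identityˡ b)))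

  -- The d of the overview, equal to q^n - q^(n-1) for x ≠ 0.
  degree : ∀ {n} → Vector n → ℕ
  degree {n} x = ∑ (allVecs n) (λ f → ⟦ nonZero (dot f x) ⟧)

  q*degree : ∀ {n} {x : Vector n} → x ≢ zeroV → q ℕ.* degree x ≡ (q ∸ 1) ℕ.* ∑ (allVecs n) (λ _ → 1)
  q*degree {n} {x} nx = let h , hx = dual x nx in
    trans (cong (q ℕ.*_) (∑-cong (allVecs n) (λ f → sym (ℕₚ.*-identityˡ _)))) (equidistribution (λ _ → 1) x h hx (λ _ _ → refl))

  q≢0 : ℕ.NonZero q
  q≢0 = ℕ.>-nonZero (ℕₚ.<⇒≤ 1<q)

  degree-const : ∀ {n} {x y : Vector n} → x ≢ zeroV → y ≢ zeroV → degree x ≡ degree y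
  degree-const {x = x} {y} nx ny = ℕₚ.*-cancelˡ-≡ (degree x) (degree y) q ⦃ q≢0 ⦄ (trans (q*degree nx) (sym (q*degree ny)))

  degree>0 : ∀ {n} {x : Vector n} → x ≢ zeroV → 0 < degree x
  degree>0 {n} {x} nx with dual x nx
  ... | h , hx = ℕₚ.n≢0⇒n>0 λ z → absurd (trans (cong ⟦_⟧ (sym (nonZero-yes (λ e → 0≢1 (trans (sym e) hx)))))
        (sym (∑-tight (allVecs n) {λ _ → 0} (λ _ → z≤n) (ℕₚ.≤-reflexive (trans z (sym (∑-zero (allVecs n))))) (allVecs-complete h))))
    where
    absurd : 1 ≡ 0 → ⊥
    absurd ()

  -- Nonvanishing at two distinct points is independent: a functional h that is 0 at x and 1 at y
  -- translates the values at y and leaves those at x alone.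
  pair-degree : ∀ {n} (x y : Pt n) → y ≢ x →
    q ℕ.* ∑ (allVecs n) (λ f → ⟦ nonZero (dot f (proj₁ x)) ⟧ ℕ.* ⟦ nonZero (dot f (proj₁ y)) ⟧) ≡ (q ∸ 1) ℕ.* degree (proj₁ x)
  pair-degree x y ne with separate (proj₁ x) (proj₁ y) (point≢0 x)
  ... | inj₁ (h , hx , hy) = equidistribution (λ f → ⟦ nonZero (dot f (proj₁ x)) ⟧) (proj₁ y) h hy
        (λ c f → cong (⟦_⟧ ∘ nonZero) (trans (dot-⊕ˡ f _ _) (trans (cong (dot f (proj₁ x) +_) (trans (dot-⊙ˡ c h _) (trans (cong (c *_) hx) (zeroʳ c)))) (+-identityʳ _))))
  ... | inj₂ (c , eq) with c ≟ 0#
  ... | yes refl = ⊥-elim (point≢0 y (trans eq (0⊙ _)))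
  ... | no nc = ⊥-elim (ne (∼-unique {p = y} {x} (∼-refl y) (c , nc , eq)))

  -- Weights and cogirth

  module Weighted (r : ℕ) (E : PtSet r) (w : Pt r → ℕ) where

    -- Extending w by zero lets every sum run over all of P_r and lets points outside E take part in
    -- the double count.
    w̃ : Pt r → ℕ
    w̃ p = if E p then w p else 0

    W : ℕ
    W = wt w E

    C⟨_⟩ : Vector r → PtSet r
    C⟨ f ⟩ p = E p ∧ nonZero (dot f (proj₁ p))

    W⟨_⟩ : Vector r → ℕ
    W⟨ f ⟩ = wt w C⟨ f ⟩

    W⟨⟩-sum : ∀ f → W⟨ f ⟩ ≡ ∑ (allPts r) (λ p → w̃ p ℕ.* ⟦ nonZero (dot f (proj₁ p)) ⟧)
    W⟨⟩-sum f = ∑-cong (allPts r) λ p → masked (E p) (nonZero (dot f (proj₁ p))) (w p)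
      where
      masked : ∀ a b m → (if a ∧ b then m else 0) ≡ (if a then m else 0) ℕ.* ⟦ b ⟧
      masked true true m = sym (ℕₚ.*-identityʳ m)
      masked true false m = sym (ℕₚ.*-zeroʳ m)
      masked false _ _ = refl

    -- After exchanging the sums, a point y ≠ x contributes (q - 1) d `w̃ y` by `pair-degree`,
    -- whereas y = x contributes q d `w̃ x`. The surplus d `w̃ x` is the last summand.
    double-count : ∀ x → q ℕ.* ∑ (allVecs r) (λ f → ⟦ nonZero (dot f (proj₁ x)) ⟧ ℕ.* W⟨ f ⟩) ≡
      degree (proj₁ x) ℕ.* ((q ∸ 1) ℕ.* W ℕ.+ w̃ x)
    double-count x = begin
      q ℕ.* ∑ fs (λ f → [ f ∣ x ] ℕ.* W⟨ f ⟩) ≡⟨ cong (q ℕ.*_) (∑-cong fs λ f → trans (cong ([ f ∣ x ] ℕ.*_) (W⟨⟩-sum f)) (sym (∑-*ˡ ps [ f ∣ x ] _))) ⟩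
      q ℕ.* ∑ fs (λ f → ∑ ps (λ y → [ f ∣ x ] ℕ.* (w̃ y ℕ.* [ f ∣ y ]))) ≡⟨ cong (q ℕ.*_) (∑-swap fs ps _) ⟩
      q ℕ.* ∑ ps (λ y → ∑ fs (λ f → [ f ∣ x ] ℕ.* (w̃ y ℕ.* [ f ∣ y ]))) ≡⟨ ∑-*ˡ ps q _ ⟨
      ∑ ps (λ y → q ℕ.* ∑ fs (λ f → [ f ∣ x ] ℕ.* (w̃ y ℕ.* [ f ∣ y ]))) ≡⟨ ∑-cong ps term ⟩
      ∑ ps (λ y → d ℕ.* ((q ∸ 1) ℕ.* w̃ y ℕ.+ ⟦ ⌊ y ≟ₚ x ⌋ ⟧ ℕ.* w̃ y)) ≡⟨ trans (∑-*ˡ ps d _) (cong (d ℕ.*_) (∑-+ ps _ _)) ⟩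
      d ℕ.* (∑ ps (λ y → (q ∸ 1) ℕ.* w̃ y) ℕ.+ ∑ ps (λ y → ⟦ ⌊ y ≟ₚ x ⌋ ⟧ ℕ.* w̃ y)) ≡⟨ cong (d ℕ.*_) (cong₂ ℕ._+_ (∑-*ˡ ps (q ∸ 1) w̃)
          (trans (∑-supported ps _ x (allPts-unique r) (allPts-complete x) (λ y ne → cong (ℕ._* w̃ y) (⟦⌊⌋⟧-no (y ≟ₚ x) ne)))
             (trans (cong (ℕ._* w̃ x) (⟦⌊⌋⟧-yes (x ≟ₚ x) refl)) (ℕₚ.*-identityˡ _)))) ⟩
      d ℕ.* ((q ∸ 1) ℕ.* W ℕ.+ w̃ x) ∎
      where
      open ≡-Reasoning
      fs = allVecs r
      ps = allPts r
      d = degree (proj₁ x)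
      [_∣_] : Vector r → Pt r → ℕ
      [ f ∣ y ] = ⟦ nonZero (dot f (proj₁ y)) ⟧
      idem : ∀ b → ⟦ b ⟧ ℕ.* ⟦ b ⟧ ≡ ⟦ b ⟧
      idem true = refl
      idem false = refl
      assoc₁ : ∀ a b c → a ℕ.* (b ℕ.* c) ≡ b ℕ.* (a ℕ.* c)
      assoc₁ = solve-∀
      assoc₂ : ∀ m d v → v ℕ.* (m ℕ.* d) ≡ d ℕ.* (m ℕ.* v ℕ.+ 0 ℕ.* v)
      assoc₂ = solve-∀
      assoc₃ : ∀ m d v → v ℕ.* (suc m ℕ.* d) ≡ d ℕ.* (m ℕ.* v ℕ.+ 1 ℕ.* v)
      assoc₃ = solve-∀
      term : ∀ y → q ℕ.* ∑ fs (λ f → [ f ∣ x ] ℕ.* (w̃ y ℕ.* [ f ∣ y ])) ≡ d ℕ.* ((q ∸ 1) ℕ.* w̃ y ℕ.+ ⟦ ⌊ y ≟ₚ x ⌋ ⟧ ℕ.* w̃ y)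
      term y = trans (cong (q ℕ.*_) (trans (∑-cong fs (λ f → assoc₁ [ f ∣ x ] (w̃ y) [ f ∣ y ])) (∑-*ˡ fs (w̃ y) _)))
        (trans (assoc₁ q (w̃ y) _) (pairs y))
        where
        pairs : ∀ y → w̃ y ℕ.* (q ℕ.* ∑ fs (λ f → [ f ∣ x ] ℕ.* [ f ∣ y ])) ≡ d ℕ.* ((q ∸ 1) ℕ.* w̃ y ℕ.+ ⟦ ⌊ y ≟ₚ x ⌋ ⟧ ℕ.* w̃ y)
        pairs y with y ≟ₚ x
        ... | yes refl = trans (cong (λ s → w̃ y ℕ.* (q ℕ.* s)) (∑-cong fs λ f → idem (nonZero (dot f (proj₁ y)))))
                (trans (cong (λ s → w̃ y ℕ.* (s ℕ.* d)) (sym (ℕₚ.m+[n∸m]≡n (ℕₚ.<⇒≤ 1<q)))) (assoc₃ (q ∸ 1) d (w̃ y)))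
        ... | no ne = trans (cong (w̃ y ℕ.*_) (pair-degree x y ne)) (assoc₂ (q ∸ 1) d (w̃ y))

  module _ {n} (w : Pt n → ℕ) where
    wt-mono : ∀ {X Y} → X ⊆S Y → wt w X ≤ wt w Y
    wt-mono {X} {Y} sub = ∑-mono (allPts n) λ p → le (X p) (Y p) (sub p) (w p)
      where
      le : ∀ a b → (T a → T b) → ∀ m → (if a then m else 0) ≤ (if b then m else 0)
      le false _ _ _ = z≤n
      le true true _ _ = ℕₚ.≤-refl
      le true false f _ = ⊥-elim (f _)

    wt-split : ∀ {X Y} → X ⊆S Y → wt w X ℕ.+ wt w (Y ∖ X) ≡ wt w Y
    wt-split {X} {Y} sub = trans (sym (∑-+ (allPts n) _ _)) (∑-cong (allPts n) λ p → eq (X p) (Y p) (sub p) (w p))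
      where
      eq : ∀ a b → (T a → T b) → ∀ m → (if a then m else 0) ℕ.+ (if b ∧ not a then m else 0) ≡ (if b then m else 0)
      eq true true _ m = ℕₚ.+-identityʳ m
      eq false true _ m = refl
      eq false false _ _ = refl
      eq true false f _ = ⊥-elim (f _)

  -- Cogirth in terms of functionals, and the inequality

  module Cogirth (r : ℕ) (E : PtSet r) (w : Pt r → ℕ) (basisE : ContainsBasis r E)
    (pos : ∀ p → p ∈S E → 0 < w p) (g : ℕ) (cog : IsCogirth r E w g) where
    open Weighted r E w public

    C⟨⟩-⊆ : ∀ f {X} → (∀ p → p ∈S (E ∖ X) → dot f (proj₁ p) ≡ 0#) → C⟨ f ⟩ ⊆S X
    C⟨⟩-⊆ f {X} z p p∈ = decidable-stable (T? (X p)) λ p∉ → nonZero⇒≢0 (T-∧ʳ {E p} p∈) (z p (T-∧⁺ (T-∧ˡ p∈) (T-not⁺ p∉)))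

    E∖C⟨⟩-⊆-kernel : ∀ f p → p ∈S (E ∖ C⟨ f ⟩) → dot f (proj₁ p) ≡ 0#
    E∖C⟨⟩-⊆-kernel f p p∈ = decidable-stable (dot f (proj₁ p) ≟ 0#) λ nz →
      T-not⁻ (T-∧ʳ {E p} p∈) (T-∧⁺ (T-∧ˡ p∈) (≢0⇒nonZero nz))

    -- E∖ker f is a cocircuit when no f″ has strictly smaller weight: by positivity of w, equal weights force equal supports.
    cogirth≤W⟨⟩ : ∀ f → f ≢ zeroV → g ≤ W⟨ f ⟩
    cogirth≤W⟨⟩ f f≢0 = go (suc W⟨ f ⟩) f f≢0 ℕₚ.≤-refl
      where
      go : ∀ n f → f ≢ zeroV → W⟨ f ⟩ < n → g ≤ W⟨ f ⟩
      go (suc n) f f≢0 (s≤s W≤n) with g ℕ.≤? W⟨ f ⟩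
      ... | yes le = le
      ... | no g≰ = proj₂ cog C⟨ f ⟩ ((λ p → T-∧ˡ) , hyperplane-has-no-basis f f≢0 (E∖C⟨⟩-⊆-kernel f) , minimal)
        where
        minimal : ∀ C′ → C′ ⊆S C⟨ f ⟩ → ¬ ContainsBasis r (E ∖ C′) → ∀ p → C′ p ≡ C⟨ f ⟩ p
        minimal C′ sub nb p with basis-or-hyperplane (E ∖ C′)
        ... | inj₁ b = ⊥-elim (nb b)
        ... | inj₂ (f″ , f″≢0 , z) with W⟨ f ⟩ ℕ.≤? W⟨ f″ ⟩
        -- For a lighter `f″` the descent already gives g ≤ `W⟨ f″ ⟩` < `W⟨ f ⟩`, against the
        -- assumption on f.
        ... | no W≰ = ⊥-elim (g≰ (ℕₚ.≤-trans (go n f″ f″≢0 (ℕₚ.<-≤-trans (ℕₚ.≰⇒> W≰) W≤n)) (ℕₚ.<⇒≤ (ℕₚ.≰⇒> W≰))))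
        ... | yes W≤ = T-ext (sub p) λ p∈ → C⟨⟩-⊆ f″ z p (same p∈)
          where
          le : ∀ y → (if C⟨ f″ ⟩ y then w y else 0) ≤ (if C⟨ f ⟩ y then w y else 0)
          le y with T? (C⟨ f″ ⟩ y)
          ... | yes t = ℕₚ.≤-reflexive (trans (if-T t) (sym (if-T (sub y (C⟨⟩-⊆ f″ z y t)))))
          ... | no nt = subst (_≤ _) (sym (if-¬T nt)) z≤n
          same : p ∈S C⟨ f ⟩ → p ∈S C⟨ f″ ⟩
          same p∈ = decidable-stable (T? (C⟨ f″ ⟩ p)) λ p∉ → ℕₚ.<-irrefl
            (trans (sym (if-¬T p∉)) (trans (∑-tight (allPts r) le W≤ (allPts-complete p)) (if-T p∈))) (pos p (T-∧ˡ p∈))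

    [_∣_] : Vector r → Pt r → ℕ
    [ f ∣ x ] = ⟦ nonZero (dot f (proj₁ x)) ⟧

    d⟨_⟩ : Pt r → ℕ
    d⟨ x ⟩ = degree (proj₁ x)

    d≢0 : ∀ x → ℕ.NonZero d⟨ x ⟩
    d≢0 x = ℕ.>-nonZero (degree>0 (point≢0 x))

    -- The bracket makes the bound hold for all vectors f, as summation requires: it is 0 at the
    -- zero functional, to which the cogirth bound does not apply.
    W⟨⟩-share : ∀ x f → [ f ∣ x ] ℕ.* g ≤ [ f ∣ x ] ℕ.* W⟨ f ⟩
    W⟨⟩-share x f with dot f (proj₁ x) ≟ 0#
    ... | yes _ = z≤n
    ... | no nz = ℕₚ.+-monoˡ-≤ 0 (cogirth≤W⟨⟩ f λ { refl → nz (trans (dot-comm zeroV (proj₁ x)) (dot-zeroʳ (proj₁ x))) })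

    w̃-∉ : ∀ {p} → p ∈S compl E → w̃ p ≡ 0
    w̃-∉ p∉ = if-¬T (T-not⁻ p∉)

    w̃-∈ : ∀ {p} → p ∈S E → w̃ p ≡ w p
    w̃-∈ = if-T

    double-count-∉ : ∀ {p} → p ∈S compl E → q ℕ.* ∑ (allVecs r) (λ f → [ f ∣ p ] ℕ.* W⟨ f ⟩) ≡ d⟨ p ⟩ ℕ.* ((q ∸ 1) ℕ.* W)
    double-count-∉ {p} p∉ = trans (double-count p) (cong (d⟨ p ⟩ ℕ.*_) (trans (cong ((q ∸ 1) ℕ.* W ℕ.+_) (w̃-∉ p∉)) (ℕₚ.+-identityʳ _)))

    q*-swap : ∀ x → q ℕ.* ∑ (allVecs r) (λ f → [ f ∣ x ] ℕ.* g) ≡ d⟨ x ⟩ ℕ.* (q ℕ.* g)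
    q*-swap x = trans (cong (q ℕ.*_) (∑-*ʳ (allVecs r) [_∣ x ] g)) (rearrange q d⟨ x ⟩ g)
      where
      rearrange : ∀ q d g → q ℕ.* (d ℕ.* g) ≡ d ℕ.* (q ℕ.* g)
      rearrange = solve-∀

    inequality : ∀ p → p ∈S compl E → q ℕ.* g ≤ (q ∸ 1) ℕ.* W
    inequality p p∉ = ℕₚ.*-cancelˡ-≤ d⟨ p ⟩ ⦃ d≢0 p ⦄ (begin
      d⟨ p ⟩ ℕ.* (q ℕ.* g) ≡⟨ q*-swap p ⟨
      q ℕ.* ∑ (allVecs r) (λ f → [ f ∣ p ] ℕ.* g) ≤⟨ ℕₚ.*-monoʳ-≤ q (∑-mono (allVecs r) (W⟨⟩-share p)) ⟩
      q ℕ.* ∑ (allVecs r) (λ f → [ f ∣ p ] ℕ.* W⟨ f ⟩) ≡⟨ double-count-∉ p∉ ⟩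
      d⟨ p ⟩ ℕ.* ((q ∸ 1) ℕ.* W) ∎)
      where open ℕₚ.≤-Reasoning

    -- Consequences of equality

    module Equality (eq : q ℕ.* g ≡ (q ∸ 1) ℕ.* W) where

      -- Equality leaves no slack in the sum that proved the inequality, taken at this p, hence none
      -- in the term of f, whose bracket is 1.
      W⟨⟩≡g : ∀ {p} → p ∈S compl E → ∀ f → dot f (proj₁ p) ≢ 0# → W⟨ f ⟩ ≡ g
      W⟨⟩≡g {p} p∉ f nz = sym (begin
        g ≡⟨ ℕₚ.*-identityˡ g ⟨
        1 ℕ.* g ≡⟨ cong (ℕ._* g) one ⟨
        [ f ∣ p ] ℕ.* g ≡⟨ ∑-tight (allVecs r) (W⟨⟩-share p) tight (allVecs-complete f) ⟩
        [ f ∣ p ] ℕ.* W⟨ f ⟩ ≡⟨ cong (ℕ._* W⟨ f ⟩) one ⟩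
        1 ℕ.* W⟨ f ⟩ ≡⟨ ℕₚ.*-identityˡ _ ⟩
        W⟨ f ⟩ ∎)
        where
        open ≡-Reasoning
        one : [ f ∣ p ] ≡ 1
        one = cong ⟦_⟧ (nonZero-yes nz)
        tight = ℕₚ.≤-reflexive (ℕₚ.*-cancelˡ-≡ _ _ q ⦃ q≢0 ⦄
          (trans (double-count-∉ p∉) (trans (cong (d⟨ p ⟩ ℕ.*_) (sym eq)) (sym (q*-swap p)))))

      -- A functional nonzero at x is nonzero at p or at p′, so all functionals counted at x have
      -- weight g. The double count at x then equals that of a weightless point, while points of E
      -- have positive weight.
      compl-closed : Closed (compl E)
      compl-closed p p′ x a b p∉ p′∉ x≡ = T-not⁺ λ x∈ → ℕₚ.<-irrefl (trans (sym weightless) (w̃-∈ x∈)) (pos x x∈)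
        where
        open ≡-Reasoning
        dot-x : ∀ f → dot f (proj₁ p) ≡ 0# → dot f (proj₁ p′) ≡ 0# → dot f (proj₁ x) ≡ 0#
        dot-x f z z′ = trans (cong (dot f) x≡) (trans (dot-⊕ʳ f _ _) (trans (cong₂ _+_
          (trans (dot-⊙ʳ f a _) (trans (cong (a *_) z) (zeroʳ a))) (trans (dot-⊙ʳ f b _) (trans (cong (b *_) z′) (zeroʳ b)))) (+-identityʳ 0#)))
        share : ∀ f → [ f ∣ x ] ℕ.* W⟨ f ⟩ ≡ [ f ∣ x ] ℕ.* g
        share f with dot f (proj₁ p) ≟ 0# | dot f (proj₁ p′) ≟ 0#
        ... | no nz | _ = cong ([ f ∣ x ] ℕ.*_) (W⟨⟩≡g p∉ f nz)
        ... | yes _ | no nz′ = cong ([ f ∣ x ] ℕ.*_) (W⟨⟩≡g p′∉ f nz′)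
        ... | yes z | yes z′ rewrite nonZero-no (dot-x f z z′) = refl
        weightless : w̃ x ≡ 0
        weightless = ℕₚ.+-cancelˡ-≡ ((q ∸ 1) ℕ.* W) _ _ (ℕₚ.*-cancelˡ-≡ _ _ d⟨ x ⟩ ⦃ d≢0 x ⦄ (begin
          d⟨ x ⟩ ℕ.* ((q ∸ 1) ℕ.* W ℕ.+ w̃ x) ≡⟨ double-count x ⟨
          q ℕ.* ∑ (allVecs r) (λ f → [ f ∣ x ] ℕ.* W⟨ f ⟩) ≡⟨ cong (q ℕ.*_) (∑-cong (allVecs r) share) ⟩
          q ℕ.* ∑ (allVecs r) (λ f → [ f ∣ x ] ℕ.* g) ≡⟨ q*-swap x ⟩
          d⟨ x ⟩ ℕ.* (q ℕ.* g) ≡⟨ cong (d⟨ x ⟩ ℕ.*_) (trans eq (sym (ℕₚ.+-identityʳ _))) ⟩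
          d⟨ x ⟩ ℕ.* ((q ∸ 1) ℕ.* W ℕ.+ 0) ∎))

      collinear-weights : ∀ {p x y a b} → p ∈S compl E → a ≢ 0# → proj₁ y ≡ a ⊙ proj₁ x ⊕ b ⊙ proj₁ p → w̃ x ≡ w̃ y
      collinear-weights {p} {x} {y} {a} {b} p∉ na y≡ =
        ℕₚ.+-cancelˡ-≡ ((q ∸ 1) ℕ.* W) _ _ (ℕₚ.*-cancelˡ-≡ _ _ d⟨ x ⟩ ⦃ d≢0 x ⦄ (begin
          d⟨ x ⟩ ℕ.* ((q ∸ 1) ℕ.* W ℕ.+ w̃ x) ≡⟨ double-count x ⟨
          q ℕ.* S x ≡⟨ cong (q ℕ.*_) S-equal ⟩
          q ℕ.* S y ≡⟨ double-count y ⟩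
          d⟨ y ⟩ ℕ.* ((q ∸ 1) ℕ.* W ℕ.+ w̃ y) ≡⟨ cong (ℕ._* _) d-equal ⟨
          d⟨ x ⟩ ℕ.* ((q ∸ 1) ℕ.* W ℕ.+ w̃ y) ∎))
        where
        open ≡-Reasoning
        S : Pt r → ℕ
        S z = ∑ (allVecs r) (λ f → [ f ∣ z ] ℕ.* W⟨ f ⟩)
        d-equal : d⟨ x ⟩ ≡ d⟨ y ⟩
        d-equal = degree-const (point≢0 x) (point≢0 y)
        dot-y : ∀ f → dot f (proj₁ p) ≡ 0# → dot f (proj₁ y) ≡ (a * dot f (proj₁ x))
        dot-y f z = trans (cong (dot f) y≡) (trans (dot-⊕ʳ f _ _) (trans (cong₂ _+_ (dot-⊙ʳ f a _)
          (trans (dot-⊙ʳ f b _) (trans (cong (b *_) z) (zeroʳ b)))) (+-identityʳ _)))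
        -- A functional killing p vanishes at both or neither of x and y; any other has W⟨ f ⟩ = g.
        exchange : ∀ f → [ f ∣ x ] ℕ.* W⟨ f ⟩ ℕ.+ [ f ∣ y ] ℕ.* g ≡ [ f ∣ y ] ℕ.* W⟨ f ⟩ ℕ.+ [ f ∣ x ] ℕ.* g
        exchange f with dot f (proj₁ p) ≟ 0#
        ... | yes z rewrite dot-y f z | nonZero-* (dot f (proj₁ x)) na = refl
        ... | no nz rewrite W⟨⟩≡g p∉ f nz = ℕₚ.+-comm ([ f ∣ x ] ℕ.* g) _
        -- `exchange` says without subtraction that `W⟨ f ⟩` - g is counted equally often at x and
        -- at y. The added multiples of g sum to the same total at both points and cancel.
        S-equal : S x ≡ S y
        S-equal = ℕₚ.+-cancelʳ-≡ (d⟨ x ⟩ ℕ.* g) _ _ (begin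
          S x ℕ.+ d⟨ x ⟩ ℕ.* g ≡⟨ cong (λ d → S x ℕ.+ d ℕ.* g) d-equal ⟩
          S x ℕ.+ d⟨ y ⟩ ℕ.* g ≡⟨ cong (S x ℕ.+_) (∑-*ʳ (allVecs r) [_∣ y ] g) ⟨
          S x ℕ.+ ∑ (allVecs r) (λ f → [ f ∣ y ] ℕ.* g) ≡⟨ ∑-+ (allVecs r) _ _ ⟨
          ∑ (allVecs r) (λ f → [ f ∣ x ] ℕ.* W⟨ f ⟩ ℕ.+ [ f ∣ y ] ℕ.* g) ≡⟨ ∑-cong (allVecs r) exchange ⟩
          ∑ (allVecs r) (λ f → [ f ∣ y ] ℕ.* W⟨ f ⟩ ℕ.+ [ f ∣ x ] ℕ.* g) ≡⟨ ∑-+ (allVecs r) _ _ ⟩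
          S y ℕ.+ ∑ (allVecs r) (λ f → [ f ∣ x ] ℕ.* g) ≡⟨ cong (S y ℕ.+_) (∑-*ʳ (allVecs r) [_∣ x ] g) ⟩
          S y ℕ.+ d⟨ x ⟩ ℕ.* g ∎)

      -- The witness k is the size of a basis `ps` of the complement, a subspace by `compl-closed`;
      -- it is positive because of p₀ and below r because E has a point.
      complement-conditions : ∀ p₀ → p₀ ∈S compl E → Σ ℕ λ k → 1 ≤ k × k < r × Iso (compl E) (full {k}) ×
        (∀ (P : PtSet r) → Iso P (full {suc k}) → compl E ⊆S P → ∀ p p′ → p ∈S (P ∩ E) → p′ ∈S (P ∩ E) → w p ≡ w p′)
      complement-conditions p₀ p₀∉ with basisOfSet (compl E)
      ... | ps , ps∉ , li , inside = length ps , nonempty ps inside , proper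
          , span⇒full-iso (coords ps) li (length-map proj₁ ps) inside outside , constant
        where
        outside : ∀ p → Span (coords ps) (proj₁ p) → p ∈S compl E
        outside = closed-Span compl-closed ps ps∉
        nonempty : ∀ ps → (∀ p → p ∈S compl E → Span (coords ps) (proj₁ p)) → 1 ≤ length ps
        nonempty [] sp = ⊥-elim (point≢0 p₀ (sym (proj₂ (sp p₀ p₀∉))))
        nonempty (_ ∷ _) _ = s≤s z≤n
        E-point : ContainsBasis r E → ∃ λ p → p ∈S E
        -- An empty basis means r = 0, and P_0 has no room for p₀.
        E-point ([] , _ , refl , _) = ⊥-elim (empty p₀)
          where
          empty : Pt 0 → ⊥
          empty ([] , ())
        E-point (p ∷ _ , p∈ ∷ _ , _) = p , p∈
        proper : length ps < r
        proper = ℕₚ.≰⇒> λ r≤k → let p , p∈ = E-point basisE in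
          T-not⁻ (outside p (LI⇒spanning {vs = coords ps} li (ℕₚ.≤-trans r≤k (ℕₚ.≤-reflexive (sym (length-map proj₁ ps)))) (proj₁ p))) p∈
        constant : ∀ (P : PtSet r) → Iso P (full {suc (length ps)}) → compl E ⊆S P → ∀ x y → x ∈S (P ∩ E) → y ∈S (P ∩ E) → w x ≡ w y
        -- Otherwise x, y and `ps` would be k + 2 independent points of P, which has rank k + 1. So
        -- x is a multiple of y plus a vector in the span of the complement, and `collinear-weights`
        -- applies.
        constant P I sub x y x∈ y∈ with decidable-stable (Span? (coords (y ∷ ps)) (proj₁ x)) (λ x∉ → ℕₚ.<-irrefl refl
             (full-iso⇒length≤ I {x ∷ y ∷ ps} (T-∧ˡ x∈ ∷ T-∧ˡ y∈ ∷ All.map (λ {p} → sub p) ps∉)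
               (LI-∷ {vs = coords (y ∷ ps)} (LI-∷ {vs = coords ps} li y-off) x∉)))
          where
          y-off : ¬ Span (coords ps) (proj₁ y)
          y-off sp = T-not⁻ (outside y sp) (T-∧ʳ {P y} y∈)
        ... | a ∷ c , x≡ = trans (sym (w̃-∈ (T-∧ʳ {P x} x∈))) (trans (sym (line (⟨ comb (coords ps) ⟩ c) (c , refl) x≡)) (w̃-∈ (T-∧ʳ {P y} y∈)))
          where
          line : ∀ v → Span (coords ps) v → a ⊙ proj₁ y ⊕ v ≡ proj₁ x → w̃ y ≡ w̃ x
          line v sp eq′ with a ≟ 0#
          ... | yes refl = ⊥-elim (T-not⁻ (outside x (subst (Span (coords ps)) (trans (sym (trans (cong (_⊕ v) (0⊙ _)) (⊕-identityˡ v))) eq′) sp)) (T-∧ʳ {P x} x∈))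
          ... | no na with v ≟ᵥ zeroV
          ... | yes refl = cong w̃ (sym (∼-unique {p = x} {y} (∼-refl x) (a , na , trans (sym eq′) (⊕-identityʳ _))))
          ... | no nv with pointOf v nv
          ... | p , p∼@(b , nb , v≡) = collinear-weights {p} {y} {x} {a} {b}
                (outside p (let d , _ , e = ∼-sym {p = p} p∼ in subst (Span (coords ps)) (sym e) (Span-⊙ {vs = coords ps} d sp)))
                na (trans (sym eq′) (cong (a ⊙ proj₁ y ⊕_) v≡))

      -- The rest of E lies in some hyperplane f = 0, so N contains `C⟨ f ⟩` and weighs at least g.
      -- Then (q - 1) w(M) = q g ≤ q w(N), and splitting w(M) along N and cancelling (q - 1) w(N)
      -- leaves the claim.
      affine-condition : ∀ N → N ⊆S E → ¬ ContainsBasis r (E ∖ N) → (q ∸ 1) ℕ.* wt w (E ∖ N) ≤ wt w N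
      affine-condition N sub nb with basis-or-hyperplane (E ∖ N)
      ... | inj₁ b = ⊥-elim (nb b)
      ... | inj₂ (f , f≢0 , z) = ℕₚ.+-cancelˡ-≤ ((q ∸ 1) ℕ.* wt w N) _ _ (begin
        (q ∸ 1) ℕ.* wt w N ℕ.+ (q ∸ 1) ℕ.* wt w (E ∖ N) ≡⟨ ℕₚ.*-distribˡ-+ (q ∸ 1) (wt w N) _ ⟨
        (q ∸ 1) ℕ.* (wt w N ℕ.+ wt w (E ∖ N)) ≡⟨ cong ((q ∸ 1) ℕ.*_) (wt-split w sub) ⟩
        (q ∸ 1) ℕ.* W ≡⟨ eq ⟨
        q ℕ.* g ≤⟨ ℕₚ.*-monoʳ-≤ q (ℕₚ.≤-trans (cogirth≤W⟨⟩ f f≢0) (wt-mono w (C⟨⟩-⊆ f z))) ⟩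
        q ℕ.* wt w N ≡⟨ cong (ℕ._* wt w N) (ℕₚ.m+[n∸m]≡n (ℕₚ.<⇒≤ 1<q)) ⟨
        wt w N ℕ.+ (q ∸ 1) ℕ.* wt w N ≡⟨ ℕₚ.+-comm (wt w N) _ ⟩
        (q ∸ 1) ℕ.* wt w N ℕ.+ wt w N ∎)
        where open ℕₚ.≤-Reasoning

  -- Affine restrictions

  tailMap : ∀ {n} → LinearMap (suc n) n
  tailMap = record { ⟨_⟩ = V.tail ; ⟨⟩-⊕ = λ { (_ ∷ _) (_ ∷ _) → refl } ; ⟨⟩-⊙ = λ { _ (_ ∷ _) → refl } }

  zero∷Map : ∀ {n} → LinearMap n (suc n)
  zero∷Map = record { ⟨_⟩ = 0# ∷_ ; ⟨⟩-⊕ = λ _ _ → cong (_∷ _) (sym (+-identityˡ 0#)) ; ⟨⟩-⊙ = λ c _ → cong (_∷ _) (sym (zeroʳ c)) }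

  keepHead : ∀ {m n} → LinearMap m n → LinearMap (suc m) (suc n)
  keepHead L = record
    { ⟨_⟩ = λ { (x ∷ v) → x ∷ ⟨ L ⟩ v }
    ; ⟨⟩-⊕ = λ { (_ ∷ u) (_ ∷ v) → cong (_ ∷_) (⟨⟩-⊕ L u v) }
    ; ⟨⟩-⊙ = λ { c (_ ∷ v) → cong (_ ∷_) (⟨⟩-⊙ L c v) } }

  -- L deletes the coordinate at the first nonzero entry of f; on the hyperplane that coordinate is
  -- determined by the others.
  dropCoordinate : ∀ {n} (f : Vector (suc n)) → f ≢ zeroV →
    ∃ λ (L : LinearMap (suc n) n) → ∀ v → dot f v ≡ 0# → ⟨ L ⟩ v ≡ zeroV → v ≡ zeroV
  dropCoordinate {n} (a ∷ f) f≢0 with a ≟ 0#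
  ... | no na = tailMap , λ { (x ∷ v) e refl → cong (_∷ zeroV)
        (*-cancelˡ-zero na (trans (sym (trans (cong ((a * x) +_) (dot-zeroʳ f)) (+-identityʳ _))) e)) }
  dropCoordinate {zero} (_ ∷ []) f≢0 | yes refl = ⊥-elim (f≢0 refl)
  dropCoordinate {suc n} (_ ∷ f) f≢0 | yes refl with dropCoordinate f (f≢0 ∘ cong (0# ∷_))
  ... | L , inj = keepHead L , λ { (x ∷ v) e eq → cong₂ _∷_ (Vecₚ.∷-injectiveˡ eq)
        (inj v (trans (sym (trans (cong (_+ dot f v) (zeroˡ x)) (+-identityˡ _))) e) (Vecₚ.∷-injectiveʳ eq)) }

  -- J inserts a 0 where x has its first nonzero entry, so its image is a coordinate hyperplane
  -- avoiding x.
  complementaryMap : ∀ {n} (x : Vector (suc n)) → x ≢ zeroV → ∃ λ (J : LinearMap n (suc n)) → Injective J × (∀ d → ⟨ J ⟩ d ≢ x)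
  complementaryMap {n} (a ∷ x) x≢0 with a ≟ 0#
  ... | no na = zero∷Map , (λ _ → Vecₚ.∷-injectiveʳ) , λ _ e → na (sym (Vecₚ.∷-injectiveˡ e))
  complementaryMap {zero} (_ ∷ []) x≢0 | yes refl = ⊥-elim (x≢0 refl)
  complementaryMap {suc n} (_ ∷ x) x≢0 | yes refl with complementaryMap x (x≢0 ∘ cong (0# ∷_))
  ... | J , inj , off = keepHead J
      , (λ { (y ∷ d) e → cong₂ _∷_ (Vecₚ.∷-injectiveˡ e) (inj d (Vecₚ.∷-injectiveʳ e)) })
      , λ { (y ∷ d) e → off d (Vecₚ.∷-injectiveʳ e) }

  affine⁻ : ∀ {n} (p : Pt (suc n)) → p ∈S affine → V.head (proj₁ p) ≢ 0#
  affine⁻ (_ ∷ _ , _) = nonZero⇒≢0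

  affine⁺ : ∀ {n} (p : Pt (suc n)) → V.head (proj₁ p) ≢ 0# → p ∈S affine
  affine⁺ (_ ∷ _ , _) = ≢0⇒nonZero

  affine-head : ∀ {n} (p : Pt (suc n)) → p ∈S affine → V.head (proj₁ p) ≡ 1#
  affine-head (x ∷ v , t) p∈ with x ≟ 0#
  ... | no _ = toWitness t

  -- M takes f as first coordinate and completes it by `dropCoordinate`, so it carries the
  -- hyperplane f = 0 to the one removed in `affine`.
  hyperplane-complement-iso : ∀ {r} (f : Vector r) → f ≢ zeroV → Iso (λ p → nonZero (dot f (proj₁ p))) (affine {r})
  hyperplane-complement-iso {zero} [] f≢0 = ⊥-elim (f≢0 refl)
  hyperplane-complement-iso {suc n} f f≢0 with dropCoordinate f f≢0
  ... | L , inj = Iso-sym (linear-iso M M-injective image preimage)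
    where
    M : LinearMap (suc n) (suc n)
    M = record { ⟨_⟩ = λ v → dot f v ∷ ⟨ L ⟩ v ; ⟨⟩-⊕ = λ u v → cong₂ _∷_ (dot-⊕ʳ f u v) (⟨⟩-⊕ L u v)
               ; ⟨⟩-⊙ = λ c v → cong₂ _∷_ (dot-⊙ʳ f c v) (⟨⟩-⊙ L c v) }
    M-injective : Injective M
    M-injective v e = inj v (Vecₚ.∷-injectiveˡ e) (Vecₚ.∷-injectiveʳ e)
    image : ∀ c p → ⟨ M ⟩ (proj₁ c) ∼ p → T (nonZero (dot f (proj₁ c))) → p ∈S affine
    image c p@(x ∷ _ , _) (a , _ , e) t = affine⁺ p λ { refl → nonZero⇒≢0 t (trans (Vecₚ.∷-injectiveˡ e) (zeroʳ a)) }
    preimage : ∀ p → p ∈S affine → ∃ λ c → T (nonZero (dot f (proj₁ c))) × ⟨ M ⟩ (proj₁ c) ∼ p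
    preimage p@(x ∷ _ , _) p∈ with surjective M M-injective ℕₚ.≤-refl (proj₁ p)
    ... | v , e with pointOf v (λ { refl → point≢0 p (trans (sym e) (⟨⟩-zero M)) })
    ... | c , a , na , refl = c
        , ≢0⇒nonZero (λ z → affine⁻ p p∈ (trans (sym (Vecₚ.∷-injectiveˡ e)) (trans (dot-⊙ʳ f a _) (trans (cong (a *_) z) (zeroʳ a)))))
        , a ⁻¹ , ⁻¹-≢0 na , trans (sym (⊙-inverse na _)) (cong ((a ⁻¹) ⊙_) (trans (sym (⟨⟩-⊙ M a _)) e))

  LI-pair : ∀ {n} {p p′ : Pt n} → p ≢ p′ → LI (coords (p ∷ p′ ∷ []))
  LI-pair {p = p} {p′} ne = LI-∷ {vs = coords (p′ ∷ [])} (LI-∷ {vs = []} (λ { [] _ → refl }) (λ { ([] , e) → point≢0 p′ (sym e) })) off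
    where
    off : ¬ Span (coords (p′ ∷ [])) (proj₁ p)
    off (c ∷ [] , e) with c ≟ 0#
    ... | yes refl = point≢0 p (trans (sym e) (trans (⊕-identityʳ _) (0⊙ _)))
    ... | no nc = ne (∼-unique {p = p} {p′} (∼-refl p) (c , nc , trans (sym e) (⊕-identityʳ _)))

  LI-∷⁻ : ∀ {n} {vs : List (Vector n)} {v} → LI (v ∷ vs) → ¬ Span vs v
  LI-∷⁻ {vs = vs} {v} li (c , e) = 0≢1 (sym (-≡0 (Vecₚ.∷-injectiveˡ (li ((- 1#) ∷ c)
    (trans (⊕-comm _ _) (trans (cong (_⊕ (- 1#) ⊙ v) e) (⊕-inverseʳ v)))))))

  -- The points at infinity form a copy of P_n, the same set that indexes the lines through a point.
  -- This is the equality of numbers on which the counting rests.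
  non-affine-split : ∀ {n} (c : Pt (suc n)) → (c ∈S affine) ⊎ (∃ λ (d : Pt n) → proj₁ c ≡ 0# ∷ proj₁ d)
  non-affine-split (x ∷ v , t) with x ≟ 0#
  ... | yes refl = inj₂ ((v , t) , refl)
  ... | no nx = inj₁ _

  -- The Bose–Burton argument.  Every line through x ∈ N leaves N, and the lines through x are as many as
  -- the points outside N, so each of them leaves N exactly once.
  module BoseBurton {n} {N : PtSet (suc n)} (I : Iso N (affine {suc n})) (x : Pt (suc n)) (x∈ : x ∈S N) where
    open Iso I

    J : LinearMap n (suc n)
    J = proj₁ (complementaryMap (proj₁ x) (point≢0 x))

    L : LinearMap (suc n) (suc n)
    L = extend (proj₁ x) J

    L-injective : Injective L
    L-injective = let _ , inj , off = complementaryMap (proj₁ x) (point≢0 x) in extend-injective (proj₁ x) J inj off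

    L-origin : ⟨ L ⟩ (1# ∷ zeroV) ≡ proj₁ x
    L-origin = trans (cong₂ _⊕_ (1⊙ _) (⟨⟩-zero J)) (⊕-identityʳ _)

    -- For fixed d these are the q points other than x on the line through x in direction d.
    y : (t : Carrier) (d : Pt n) → ∃ λ p → ⟨ L ⟩ (t ∷ proj₁ d) ∼ p
    y t d = pointOf (⟨ L ⟩ (t ∷ proj₁ d)) λ e → point≢0 d (Vecₚ.∷-injectiveʳ (L-injective _ e))

    proportional : ∀ {u v : Vector (suc n)} {p} → ⟨ L ⟩ u ∼ p → ⟨ L ⟩ v ∼ p → ∃ λ e → e ≢ 0# × u ≡ e ⊙ v
    proportional {u} {v} {p} (a , na , ea) b∼ with ∼-sym {p = p} b∼
    ... | b , nb , eb = a * b , *-≢0 na nb , ⟨⟩-cancel L L-injective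
          (trans ea (trans (cong (a ⊙_) eb) (trans (⊙-⊙ a b _) (sym (⟨⟩-⊙ L _ v)))))

    direction-unique : ∀ {t t′ d d′ p} → ⟨ L ⟩ (t ∷ proj₁ d) ∼ p → ⟨ L ⟩ (t′ ∷ proj₁ d′) ∼ p → d ≡ d′
    direction-unique {t} {t′} {d} {d′} {p} h h′ = let e , ne , eq = proportional {p = p} h h′ in
      ∼-unique {p = d} {d′} (∼-refl d) (e , ne , Vecₚ.∷-injectiveʳ eq)

    y-injective : ∀ {t t′} d → proj₁ (y t d) ≡ proj₁ (y t′ d) → t ≡ t′
    y-injective {t} {t′} d same with proportional {p = proj₁ (y t′ d)} (subst (⟨ L ⟩ (t ∷ proj₁ d) ∼_) same (proj₂ (y t d))) (proj₂ (y t′ d))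
    ... | e , ne , eq = trans (Vecₚ.∷-injectiveˡ eq) (trans (cong (_* t′) e≡1) (*-identityˡ t′))
      where
      e≡1 : e ≡ 1#
      e≡1 = normalised-scalar {u = proj₁ d} ne (proj₂ d) (proj₂ d) (sym (Vecₚ.∷-injectiveʳ eq))

    y≢x : ∀ t d → proj₁ (y t d) ≢ x
    y≢x t d same with proportional {v = 1# ∷ zeroV} {p = x} (subst (⟨ L ⟩ (t ∷ proj₁ d) ∼_) same (proj₂ (y t d))) (subst (_∼ x) (sym L-origin) (∼-refl x))
    ... | e , _ , eq = point≢0 d (trans (Vecₚ.∷-injectiveʳ eq) (⊙-zeroV e))

    y-collinear : ∀ t d → Span (coords (x ∷ proj₁ (y 0# d) ∷ [])) (proj₁ (proj₁ (y t d)))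
    y-collinear t d with y t d | y 0# d
    ... | p , p∼ | p₀ , (b , _ , eb) with ∼-sym {p = p} p∼
    ... | a , _ , ea = (a * t) ∷ (a * b) ∷ [] , (begin
          (a * t) ⊙ proj₁ x ⊕ ((a * b) ⊙ proj₁ p₀ ⊕ zeroV) ≡⟨ cong₂ _⊕_ (sym (⊙-⊙ a t _)) (trans (⊕-identityʳ _) (sym (⊙-⊙ a b _))) ⟩
          a ⊙ (t ⊙ proj₁ x) ⊕ a ⊙ (b ⊙ proj₁ p₀) ≡⟨ cong (λ v → a ⊙ (t ⊙ proj₁ x) ⊕ a ⊙ v) (trans (sym eb) (trans (cong (_⊕ ⟨ J ⟩ (proj₁ d)) (0⊙ _)) (⊕-identityˡ _))) ⟩
          a ⊙ (t ⊙ proj₁ x) ⊕ a ⊙ ⟨ J ⟩ (proj₁ d) ≡⟨ ⊙-distribˡ a _ _ ⟨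
          a ⊙ (t ⊙ proj₁ x ⊕ ⟨ J ⟩ (proj₁ d)) ≡⟨ ea ⟨
          proj₁ p ∎)
      where open ≡-Reasoning

    to-injective : ∀ {a b} → proj₁ (to a) ≡ proj₁ (to b) → proj₁ a ≡ proj₁ b
    to-injective {a} {b} e = cong proj₁ (trans (sym (from∘to a)) (trans (cong from (Elem-≡ e)) (from∘to b)))

    -- If all of y t d lay in N, their images would be points û + β(v̂ − û) of one affine line with q distinct
    -- parameters β ≠ 0, whence the injection α = 1 − β of the field into itself would miss 1.
    line-leaves : ∀ d → ¬ (∀ t → proj₁ (y t d) ∈S N)
    line-leaves d all = y≢x t₁ d (to-injective {_ , all t₁} {x , x∈} (Pt-≡ (trans (sym (proj₂ (proj₂ (coefficients t₁)))) at-one)))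
      where
      open ≡-Reasoning
      û : Vector (suc n)
      û = proj₁ (proj₁ (to (x , x∈)))
      v : Carrier → Pt (suc n)
      v t = proj₁ (to (_ , all t))
      -- Independent images would, by `preservesIndep`, come from three independent points, but x,
      -- `y 0# d` and `y t d` lie on a line.
      collinear : ∀ t → Span (coords (proj₁ (to (x , x∈)) ∷ v 0# ∷ [])) (proj₁ (v t))
      collinear t = decidable-stable (Span? (coords (proj₁ (to (x , x∈)) ∷ v 0# ∷ [])) (proj₁ (v t))) λ off →
        let xs = (_ , all t) ∷ (x , x∈) ∷ (_ , all 0#) ∷ []
            li = LI-∷ {vs = coords (proj₁ (to (x , x∈)) ∷ v 0# ∷ [])} (LI-pair (y≢x 0# d ∘ sym ∘ to-injective {x , x∈} {_ , all 0#})) off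
        in LI-∷⁻ {vs = coords (x ∷ proj₁ (y 0# d) ∷ [])}
             (Indep⇒LI (map proj₁ xs) (Equivalence.from (preservesIndep xs) (LI⇒Indep (map (proj₁ ∘ to) xs) li))) (y-collinear t d)
      coefficients : ∀ t → ∃ λ α → ∃ λ β → α ⊙ û ⊕ (β ⊙ proj₁ (v 0#) ⊕ zeroV) ≡ proj₁ (v t)
      coefficients t = unpack (collinear t)
        where
        unpack : ∀ {u v w : Vector (suc n)} → Span (u ∷ v ∷ []) w → ∃ λ α → ∃ λ β → α ⊙ u ⊕ (β ⊙ v ⊕ zeroV) ≡ w
        unpack (α ∷ β ∷ [] , e) = α , β , e
      α : Carrier → Carrier
      α t = proj₁ (coefficients t)
      β : Carrier → Carrier
      β t = proj₁ (proj₂ (coefficients t))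
      -- Normalised affine points have first coordinate 1; comparing first coordinates shows that
      -- the combination is affine.
      affine-sum : ∀ t → (β t + α t) ≡ 1#
      affine-sum t = trans (+-comm _ _) (heads û (proj₁ (v 0#)) (affine-head (v 0#) (proj₂ (to (_ , all 0#))))
        (affine-head (proj₁ (to (x , x∈))) (proj₂ (to (x , x∈)))) (trans (cong V.head (proj₂ (proj₂ (coefficients t)))) (affine-head (v t) (proj₂ (to (_ , all t))))))
        where
        heads : ∀ (u v : Vector (suc n)) {a b} → V.head v ≡ 1# → V.head u ≡ 1# → V.head (a ⊙ u ⊕ (b ⊙ v ⊕ zeroV)) ≡ 1# → (a + b) ≡ 1#
        heads (_ ∷ _) (_ ∷ _) {a} {b} refl refl e = trans (sym (cong₂ _+_ (*-identityʳ a) (trans (+-identityʳ _) (*-identityʳ b)))) e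
      β-determined : ∀ {s t} → α s ≡ α t → β s ≡ β t
      β-determined {s} {t} e = +-injectiveˡ (α s) (trans (affine-sum s) (sym (trans (cong (β t +_) e) (affine-sum t))))
      α-injective : ∀ {s t} → α s ≡ α t → s ≡ t
      α-injective {s} {t} e = y-injective d (to-injective {_ , all s} {_ , all t} (Pt-≡ (begin
        proj₁ (v s) ≡⟨ proj₂ (proj₂ (coefficients s)) ⟨
        α s ⊙ û ⊕ (β s ⊙ proj₁ (v 0#) ⊕ zeroV) ≡⟨ cong₂ (λ a b → a ⊙ û ⊕ (b ⊙ proj₁ (v 0#) ⊕ zeroV)) e (β-determined e) ⟩
        α t ⊙ û ⊕ (β t ⊙ proj₁ (v 0#) ⊕ zeroV) ≡⟨ proj₂ (proj₂ (coefficients t)) ⟩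
        proj₁ (v t) ∎)))
      -- α is onto the field, so some parameter yields the image û of x itself; injectivity of `to`
      -- then places x among the points `y t d`.
      one-hit : ∃ λ t → α t ≡ 1#
      one-hit = injective⇒surjective _≟_ elements unique complete α α-injective 1#
      t₁ = proj₁ one-hit
      β-zero : β t₁ ≡ 0#
      β-zero = +-injectiveˡ 1# (trans (trans (cong (β t₁ +_) (sym (proj₂ one-hit))) (affine-sum t₁)) (sym (+-identityˡ 1#)))
      at-one : α t₁ ⊙ û ⊕ (β t₁ ⊙ proj₁ (v 0#) ⊕ zeroV) ≡ û
      at-one = begin
        α t₁ ⊙ û ⊕ (β t₁ ⊙ proj₁ (v 0#) ⊕ zeroV) ≡⟨ cong₂ (λ a b → a ⊙ û ⊕ (b ⊙ proj₁ (v 0#) ⊕ zeroV)) (proj₂ one-hit) β-zero ⟩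
        1# ⊙ û ⊕ (0# ⊙ proj₁ (v 0#) ⊕ zeroV) ≡⟨ cong₂ _⊕_ (1⊙ û) (trans (⊕-identityʳ _) (0⊙ _)) ⟩
        û ⊕ zeroV ≡⟨ ⊕-identityʳ û ⟩
        û ∎

    exit : ∀ d → ∃ λ t → ¬ (proj₁ (y t d) ∈S N)
    exit d with Any.any? (λ t → ¬? (T? (N (proj₁ (y t d))))) elements
    ... | yes found = Any.satisfied found
    ... | no none = ⊥-elim (line-leaves d λ t → decidable-stable (T? _) λ off → none (lose (complete t) off))

    θ : Pt n → Pt (suc n)
    θ d = proj₁ (y (proj₁ (exit d)) d)

    θ-∼ : ∀ d → ⟨ L ⟩ (proj₁ (exit d) ∷ proj₁ d) ∼ θ d
    θ-∼ d = proj₂ (y (proj₁ (exit d)) d)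

    -- Affine points go into N through the isomorphism, points at infinity to the chosen exit points
    -- outside N. This self-map is injective, hence onto, so the exit points exhaust the complement
    -- of N.
    Θ : Pt (suc n) → Pt (suc n)
    Θ c with non-affine-split c
    ... | inj₁ c∈ = proj₁ (from (c , c∈))
    ... | inj₂ (d , _) = θ d

    Θ-injective : ∀ {c c′} → Θ c ≡ Θ c′ → c ≡ c′
    Θ-injective {c} {c′} e with non-affine-split c | non-affine-split c′
    ... | inj₁ c∈ | inj₁ c′∈ = cong proj₁ (trans (sym (to∘from (c , c∈))) (trans (cong to (Elem-≡ e)) (to∘from (c′ , c′∈))))
    ... | inj₁ c∈ | inj₂ (d , _) = ⊥-elim (proj₂ (exit d) (subst (_∈S N) e (proj₂ (from (c , c∈)))))
    ... | inj₂ (d , _) | inj₁ c′∈ = ⊥-elim (proj₂ (exit d) (subst (_∈S N) (sym e) (proj₂ (from (c′ , c′∈)))))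
    ... | inj₂ (d , eq) | inj₂ (d′ , eq′) = Pt-≡ (trans eq (trans (cong ((0# ∷_) ∘ proj₁) same) (sym eq′)))
      where
      same : d ≡ d′
      same = direction-unique {p = θ d′} (subst (⟨ L ⟩ (proj₁ (exit d) ∷ proj₁ d) ∼_) e (θ-∼ d)) (θ-∼ d′)

    θ-onto : ∀ p → p ∈S compl N → ∃ λ d → θ d ≡ p
    θ-onto p p∉ with injective⇒surjective _≟ₚ_ (allPts _) (allPts-unique _) allPts-complete Θ Θ-injective p
    ... | c , e with non-affine-split c
    ... | inj₁ c∈ = ⊥-elim (T-not⁻ p∉ (subst (_∈S N) e (proj₂ (from (c , c∈)))))
    ... | inj₂ (d , _) = d , e

    -- Both points are exit points. If x were on their join, their directions from x would agree, so
    -- they would be the same exit point and x, a multiple of it, would lie outside N.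
    not-on-secant : ∀ p p′ a b → p ∈S compl N → p′ ∈S compl N → proj₁ x ≢ a ⊙ proj₁ p ⊕ b ⊙ proj₁ p′
    not-on-secant p p′ a b p∉ p′∉ x≡ with θ-onto p p∉ | θ-onto p′ p′∉
    ... | d , refl | d′ , refl with ∼-sym {p = θ d} (θ-∼ d) | ∼-sym {p = θ d′} (θ-∼ d′)
    ... | s , _ , es | s′ , _ , es′ = tails ((a * s) ≟ 0#)
      where
      open ≡-Reasoning
      t = proj₁ (exit d)
      t′ = proj₁ (exit d′)
      origin : 1# ∷ zeroV ≡ (a * s) ⊙ (t ∷ proj₁ d) ⊕ (b * s′) ⊙ (t′ ∷ proj₁ d′)
      origin = ⟨⟩-cancel L L-injective (begin
        ⟨ L ⟩ (1# ∷ zeroV) ≡⟨ trans L-origin x≡ ⟩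
        a ⊙ proj₁ (θ d) ⊕ b ⊙ proj₁ (θ d′) ≡⟨ cong₂ _⊕_ (trans (cong (a ⊙_) es) (trans (⊙-⊙ a s _) (sym (⟨⟩-⊙ L _ _)))) (trans (cong (b ⊙_) es′) (trans (⊙-⊙ b s′ _) (sym (⟨⟩-⊙ L _ _)))) ⟩
        ⟨ L ⟩ ((a * s) ⊙ (t ∷ proj₁ d)) ⊕ ⟨ L ⟩ ((b * s′) ⊙ (t′ ∷ proj₁ d′)) ≡⟨ ⟨⟩-⊕ L ((a * s) ⊙ (t ∷ proj₁ d)) _ ⟨
        ⟨ L ⟩ ((a * s) ⊙ (t ∷ proj₁ d) ⊕ (b * s′) ⊙ (t′ ∷ proj₁ d′)) ∎)
      tail≡ : zeroV ≡ (a * s) ⊙ proj₁ d ⊕ (b * s′) ⊙ proj₁ d′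
      tail≡ = Vecₚ.∷-injectiveʳ origin
      tails : Dec ((a * s) ≡ 0#) → ⊥
      tails (yes z) with (b * s′) ≟ 0#
      ... | yes z′ = 0≢1 (sym (trans (Vecₚ.∷-injectiveˡ origin) (trans (cong₂ (λ i j → (i * t) + (j * t′)) z z′) (trans (cong₂ _+_ (zeroˡ t) (zeroˡ t′)) (+-identityˡ 0#)))))
      ... | no nz′ = ⊙-≢0 nz′ (point≢0 d′) (sym (trans tail≡ (trans (cong (λ i → i ⊙ proj₁ d ⊕ (b * s′) ⊙ proj₁ d′) z) (trans (cong (_⊕ (b * s′) ⊙ proj₁ d′) (0⊙ _)) (⊕-identityˡ _)))))
      tails (no nz) with ((((a * s) ⁻¹) * (- 1#)) * (b * s′)) ≟ 0# | trans (solve-for nz (proj₁ d) _ (sym tail≡)) (⊙-⊙ _ (b * s′) _)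
      ... | yes z | e = point≢0 d (trans e (trans (cong (_⊙ proj₁ d′) z) (0⊙ _)))
      ... | no nz″ | e with ∼-unique {p = d} {d′} (∼-refl d) (_ , nz″ , e)
      ... | refl with (a + b) ≟ 0#
      ... | yes z = point≢0 x (trans x≡ (trans (sym (⊙-distribʳ a b _)) (trans (cong (_⊙ proj₁ (θ d)) z) (0⊙ _))))
      ... | no nab = T-not⁻ p∉ (subst (_∈S N) (∼-unique {p = x} {θ d} (∼-refl x) (a + b , nab , trans x≡ (sym (⊙-distribʳ a b _)))) x∈)

  affine-complement-closed : ∀ {n} {N : PtSet (suc n)} → Iso N (affine {suc n}) → Closed (compl N)
  affine-complement-closed I p p′ x a b p∉ p′∉ x≡ = T-not⁺ λ x∈ → BoseBurton.not-on-secant I x x∈ p p′ a b p∉ p′∉ x≡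

  -- The complement of N is a subspace; with a basis inside it would be everything, but N contains
  -- the preimage of a point of `affine`. The argument `Pt r` excludes r = 0, where the empty list
  -- is a basis.
  affine-complement-has-no-basis : ∀ {r} {N S : PtSet r} → Pt r → Iso N (affine {r}) → S ⊆S compl N → ¬ ContainsBasis r S
  affine-complement-has-no-basis {zero} ([] , ())
  affine-complement-has-no-basis {suc n} _ I sub b@(ps , ps∈ , _) = T-not⁻
    (closed-Span (affine-complement-closed I) ps (All.map (λ {p} → sub p) ps∈) x (basis-spans b (proj₁ x))) x∈
    where
    e₀ : Pt (suc n)
    e₀ = 1# ∷ zeroV , normalised-1∷ (zeroV {n})
    x,x∈ = Iso.from I (e₀ , affine⁺ e₀ 1≢0)
    x = proj₁ x,x∈
    x∈ = proj₂ x,x∈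

  ∃Pt? : ∀ {n} {P : Pt n → Set} → (∀ p → Dec (P p)) → Dec (∃ P)
  ∃Pt? {n} P? = map′ Any.satisfied (λ { (p , pp) → lose (allPts-complete p) pp }) (Any.any? P? (allPts n))

  -- Sufficiency of the equality conditions

  module Converse (r : ℕ) (E : PtSet r) (w : Pt r → ℕ) (basisE : ContainsBasis r E)
    (pos : ∀ p → p ∈S E → 0 < w p) (g : ℕ) (cog : IsCogirth r E w g) where
    open Cogirth r E w basisE pos g cog

    affine-bound : ∀ N → N ⊆S E → (q ∸ 1) ℕ.* wt w (E ∖ N) ≤ wt w N → (q ∸ 1) ℕ.* W ≤ q ℕ.* wt w N
    affine-bound N sub le = begin
      (q ∸ 1) ℕ.* W ≡⟨ cong ((q ∸ 1) ℕ.*_) (wt-split w sub) ⟨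
      (q ∸ 1) ℕ.* (wt w N ℕ.+ wt w (E ∖ N)) ≡⟨ ℕₚ.*-distribˡ-+ (q ∸ 1) (wt w N) _ ⟩
      (q ∸ 1) ℕ.* wt w N ℕ.+ (q ∸ 1) ℕ.* wt w (E ∖ N) ≤⟨ ℕₚ.+-monoʳ-≤ ((q ∸ 1) ℕ.* wt w N) le ⟩
      (q ∸ 1) ℕ.* wt w N ℕ.+ wt w N ≡⟨ ℕₚ.+-comm _ (wt w N) ⟩
      (1 ℕ.+ (q ∸ 1)) ℕ.* wt w N ≡⟨ cong (ℕ._* wt w N) (ℕₚ.m+[n∸m]≡n (ℕₚ.<⇒≤ 1<q)) ⟩
      q ℕ.* wt w N ∎
      where open ℕₚ.≤-Reasoning

    -- The weight carried by every representative of a point. Translation by p acts on vectors and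
    -- not on points, hence the lift.
    u : Vector r → ℕ
    u v with v ≟ᵥ zeroV
    ... | yes _ = 0
    ... | no nv = w̃ (proj₁ (pointOf v nv))

    u-∼ : ∀ {v p} → v ∼ p → u v ≡ w̃ p
    u-∼ {v} {p} v∼ with v ≟ᵥ zeroV
    ... | yes z = ⊥-elim (∼-≢0 {p = p} v∼ z)
    ... | no nv = cong w̃ (∼-unique {p = proj₁ (pointOf v nv)} {p} (proj₂ (pointOf v nv)) v∼)

    u-zero : u zeroV ≡ 0
    u-zero with zeroV {r} ≟ᵥ zeroV
    ... | yes _ = refl
    ... | no n = ⊥-elim (n refl)

    u-⊙ : ∀ {c} v → c ≢ 0# → u (c ⊙ v) ≡ u v
    u-⊙ {c} v nc with v ≟ᵥ zeroV
    ... | yes refl = trans (cong u (⊙-zeroV c)) u-zero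
    ... | no nv = let p , v∼ = pointOf v nv in u-∼ {p = p} (∼-⊙ {p = p} nc v∼)

    ∑-u : (q ∸ 1) ℕ.* W ≡ ∑ (allVecs r) u
    ∑-u = trans (cong ((q ∸ 1) ℕ.*_) (∑-cong (allPts r) λ p → sym (u-∼ {p = p} (∼-refl p)))) (∑-points-vs-vectors u u-zero u-⊙)

    -- Here `dot` has the vector first and f second, the form in which `equidistribution` can sum
    -- over vectors with f fixed.
    ∑-u-nonZero : ∀ f → (q ∸ 1) ℕ.* W⟨ f ⟩ ≡ ∑ (allVecs r) (λ v → u v ℕ.* ⟦ nonZero (dot v f) ⟧)
    ∑-u-nonZero f = trans
      (cong ((q ∸ 1) ℕ.*_) (trans (W⟨⟩-sum f) (∑-cong (allPts r) λ p →
        cong₂ ℕ._*_ (sym (u-∼ {p = p} (∼-refl p))) (cong (⟦_⟧ ∘ nonZero) (dot-comm f _)))))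
      (∑-points-vs-vectors (λ v → u v ℕ.* ⟦ nonZero (dot v f) ⟧) (cong (ℕ._* _) u-zero)
        (λ {c} v nc → cong₂ ℕ._*_ (u-⊙ v nc) (cong ⟦_⟧ (trans (cong nonZero (dot-⊙ˡ c v f)) (nonZero-* _ nc)))))

    -- `equidistribution` with the roles exchanged: vectors are summed, f is the fixed argument, and
    -- the translation is by p scaled so that f takes the value 1 on it.
    u-invariant⇒equality : ∀ (p : Pt r) f → (∀ c v → u (v ⊕ c ⊙ proj₁ p) ≡ u v) → dot f (proj₁ p) ≢ 0# → q ℕ.* W⟨ f ⟩ ≡ (q ∸ 1) ℕ.* W
    u-invariant⇒equality p f inv nz = ℕₚ.*-cancelˡ-≡ _ _ (q ∸ 1) ⦃ ℕ.>-nonZero (ℕₚ.m<n⇒0<n∸m 1<q) ⦄ (begin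
      (q ∸ 1) ℕ.* (q ℕ.* W⟨ f ⟩) ≡⟨ swap (q ∸ 1) q W⟨ f ⟩ ⟩
      q ℕ.* ((q ∸ 1) ℕ.* W⟨ f ⟩) ≡⟨ cong (q ℕ.*_) (∑-u-nonZero f) ⟩
      q ℕ.* ∑ (allVecs r) (λ v → u v ℕ.* ⟦ nonZero (dot v f) ⟧) ≡⟨ equidistribution u f ((dot f (proj₁ p) ⁻¹) ⊙ proj₁ p)
          (trans (dot-⊙ˡ _ (proj₁ p) f) (trans (cong ((dot f (proj₁ p) ⁻¹) *_) (dot-comm (proj₁ p) f)) (⁻¹-inverseˡ nz)))
          (λ c v → trans (cong (λ z → u (v ⊕ z)) (⊙-⊙ c _ (proj₁ p))) (inv _ v)) ⟩
      (q ∸ 1) ℕ.* ∑ (allVecs r) u ≡⟨ cong ((q ∸ 1) ℕ.*_) ∑-u ⟨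
      (q ∸ 1) ℕ.* ((q ∸ 1) ℕ.* W) ∎)
      where
      open ≡-Reasoning
      swap : ∀ a b c → a ℕ.* (b ℕ.* c) ≡ b ℕ.* (a ℕ.* c)
      swap = solve-∀

    -- If v lies in the span of the complement, so does its translate and both weigh 0. Otherwise
    -- both represent points of E in the subspace spanned by the complement and v, a copy of
    -- P_(k+1), where w is constant.
    u-invariant : ∀ {k} → Iso (compl E) (full {k}) →
      (∀ (P : PtSet r) → Iso P (full {suc k}) → compl E ⊆S P → ∀ p p′ → p ∈S (P ∩ E) → p′ ∈S (P ∩ E) → w p ≡ w p′) →
      ∀ {p} → p ∈S compl E → ∀ c v → u (v ⊕ c ⊙ proj₁ p) ≡ u v
    u-invariant {k} I const {p} p∉ c v with full-iso⇒span I
    ... | ps , len , li , inside , outside = go (Span? (coords ps) v)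
      where
      open ≡-Reasoning
      p-span : ∀ a → Span (coords ps) (a ⊙ proj₁ p)
      p-span a = Span-⊙ {vs = coords ps} a (inside p p∉)
      v′ : Vector r
      v′ = v ⊕ c ⊙ proj₁ p
      v′-span : Span (coords ps) v → Span (coords ps) v′
      v′-span sp = Span-⊕ {vs = coords ps} sp (p-span c)
      v-span : Span (coords ps) v′ → Span (coords ps) v
      v-span sp = subst (Span (coords ps)) (trans (⊕-assoc v _ _) (trans (cong (v ⊕_) (⊕-inverseʳ _)) (⊕-identityʳ v)))
        (Span-⊕ {vs = coords ps} sp (Span-⊙ {vs = coords ps} (- 1#) (p-span c)))
      point-span : ∀ {z x} → z ∼ x → Span (coords ps) (proj₁ x) → Span (coords ps) z
      point-span (a , _ , e) sp = subst (Span (coords ps)) (sym e) (Span-⊙ {vs = coords ps} a sp)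
      u-span : ∀ z → Span (coords ps) z → u z ≡ 0
      u-span z sp with z ≟ᵥ zeroV
      ... | yes _ = refl
      ... | no nz with pointOf z nz
      ... | x , z∼ = let a , _ , e = ∼-sym {p = x} z∼ in
            w̃-∉ (outside x (subst (Span (coords ps)) (sym e) (Span-⊙ {vs = coords ps} a sp)))
      off-span : ∀ z → ¬ Span (coords ps) z → ∃ λ x → z ∼ x × x ∈S E
      off-span z z∉ with pointOf z (λ { refl → z∉ (zeroV , ⟨⟩-zero (comb (coords ps))) })
      ... | x , z∼ = x , z∼ , decidable-stable (T? (E x)) λ x∉ → z∉ (point-span {x = x} z∼ (inside x (T-not⁺ x∉)))
      go : Dec (Span (coords ps) v) → u v′ ≡ u v
      go (yes sp) = trans (u-span v′ (v′-span sp)) (sym (u-span v sp))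
      go (no v∉) with off-span v v∉ | off-span v′ (v∉ ∘ v-span)
      ... | x , v∼ , x∈ | x′ , v′∼ , x′∈ = begin
          u v′ ≡⟨ u-∼ {p = x′} v′∼ ⟩
          w̃ x′ ≡⟨ w̃-∈ x′∈ ⟩
          w x′ ≡⟨ const P P-iso P-above x′ x (T-∧⁺ (fromWitness x′-span) x′∈) (T-∧⁺ (fromWitness (Span-head {vs = coords ps})) x∈) ⟩
          w x ≡⟨ w̃-∈ x∈ ⟨
          w̃ x ≡⟨ u-∼ {p = x} v∼ ⟨
          u v ∎
        where
        xs : List (Vector r)
        xs = coords (x ∷ ps)
        P : PtSet r
        P y = ⌊ Span? xs (proj₁ y) ⌋
        P-iso : Iso P (full {suc k})
        P-iso = span⇒full-iso xs (LI-∷ {vs = coords ps} li (v∉ ∘ point-span {x = x} v∼)) (cong suc (trans (length-map proj₁ ps) len))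
          (λ _ → toWitness) (λ _ → fromWitness)
        P-above : compl E ⊆S P
        P-above y y∉ = fromWitness (Span-tail {vs = coords ps} (inside y y∉))
        x′-span : Span xs (proj₁ x′)
        x′-span = let a , _ , ea = ∼-sym {p = x′} v′∼ ; b , _ , eb = v∼ in
          subst (Span xs) (sym ea) (Span-⊙ {vs = xs} a (Span-⊕ {vs = xs}
            (subst (Span xs) (sym eb) (Span-⊙ {vs = xs} b (Span-head {vs = coords ps}))) (Span-tail {vs = coords ps} (p-span c))))

    -- A cocircuit C attaining g contains `C⟨ f ⟩` for some nonzero f, so it suffices to bound
    -- `W⟨ f ⟩` from below for this f.
    conditions⇒≥ : EqualityConditions r E w → (q ∸ 1) ℕ.* W ≤ q ℕ.* g
    conditions⇒≥ ((k , _ , _ , I , const) , aff) with proj₁ cog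
    ... | C , (_ , nb , _) , wC≡g with basis-or-hyperplane (E ∖ C)
    ... | inj₁ b = ⊥-elim (nb b)
    ... | inj₂ (f , f≢0 , z) with ∃Pt? (λ p → T? (compl E p) ×-dec ¬? (dot f (proj₁ p) ≟ 0#))
    ... | yes (p , p∉ , nz) = ℕₚ.≤-trans (ℕₚ.≤-reflexive (sym (u-invariant⇒equality p f (u-invariant I const p∉) nz)))
          (ℕₚ.*-monoʳ-≤ q (ℕₚ.≤-trans (wt-mono w (C⟨⟩-⊆ f z)) (ℕₚ.≤-reflexive wC≡g)))
    -- The hyperplane contains the complement of E, so all points off it lie in E and form a copy N
    -- of A_r there.
    ... | no none = ℕₚ.≤-trans (affine-bound N N⊆E (aff N N⊆E (hyperplane-complement-iso f f≢0)))
          (ℕₚ.*-monoʳ-≤ q (ℕₚ.≤-trans (wt-mono w {N} λ p p∈ → C⟨⟩-⊆ f z p (T-∧⁺ (N⊆E p p∈) p∈)) (ℕₚ.≤-reflexive wC≡g)))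
      where
      N : PtSet r
      N p = nonZero (dot f (proj₁ p))
      N⊆E : N ⊆S E
      N⊆E p p∈ = decidable-stable (T? (E p)) λ p∉ → none (p , T-not⁺ p∉ , nonZero⇒≢0 p∈)

  cogirth-bound : (r : ℕ) (E : PtSet r) (w : Pt r → ℕ) → ContainsBasis r E → (∀ p → p ∈S E → 0 < w p) → ¬ Iso E (full {r}) →
    (g : ℕ) → IsCogirth r E w g →
    (q ℕ.* g ≤ (q ∸ 1) ℕ.* wt w E) × ((q ℕ.* g ≡ (q ∸ 1) ℕ.* wt w E) ⇔ EqualityConditions r E w)
  cogirth-bound r E w basisE pos notFull g cog with ∃Pt? (λ p → T? (compl E p))
  ... | no none = ⊥-elim (notFull (full-iso λ p → decidable-stable (T? (E p)) λ p∉ → none (p , T-not⁺ p∉)))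
  ... | yes (p₀ , p₀∉) = inequality p₀ p₀∉ , mk⇔
        (λ eq → let open Equality eq in complement-conditions p₀ p₀∉
              , λ N N⊆E I → affine-condition N N⊆E (affine-complement-has-no-basis p₀ I (λ p → T-∧ʳ {E p})))
        (λ conds → ℕₚ.≤-antisym (inequality p₀ p₀∉) (conditions⇒≥ conds))
    where
    open Cogirth r E w basisE pos g cog
    open Converse r E w basisE pos g cog using (conditions⇒≥)

open Defs.FiniteField using (order)
open Defs.Geometry
open import Data.Nat using (_*_)

theorem3p2 : (F : FiniteField) (r : ℕ) (E : PtSet F r) (w : Pt F r → ℕ) →
    ContainsBasis F r E →
    (∀ p → _∈S_ F p E → 0 < w p) →
    ¬ Iso F E (full F {r}) →
    (g : ℕ) → IsCogirth F r E w g →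
    (order F * g ≤ (order F ∸ 1) * wt F w E) ×
    ((order F * g ≡ (order F ∸ 1) * wt F w E) ⇔ EqualityConditions F r E w)
theorem3p2 = ProjectiveGeometry.cogirth-bound
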